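{- There is an $\mathcal{O}(n)$ time algorithm that, given an idempotent map $\iota\in I(n)$ stored in an array whose elements may be modified in the range $[-n,n]$, computes in-place of $\iota$ the corresponding idempotent permutation $\pi\in IP(n)$ (with its characteristic function defined implicitly) using $\log n$ bits of additional space.
   Context: $[n]=\{1,\ldots,n\}$. $I(n)$ is the set of idempotent maps $\iota:[n]\to[n]$ ($\iota(\iota(x))=\iota(x)$ for all $x$); $I(n,k)$ is the subset with image of cardinality $k$. For $\iota\in I(n,k)$ with fixed points $a_1<\cdots<a_k$, put $[a_i]_\iota=\{x\in[n]:\iota(x)=a_i\}$. An idempotent permutation of degree $k$ ($1\le k\le n$) is a permutation $\pi$ of $[n]$ together with a distinguished set of indices $A=\{a_1<\cdots<a_k\}\subseteq[n]$ such that the values $c_i=\pi(a_i)$ satisfy $1=c_1<c_2<\cdots<c_k$. The values $c_i$ are called the fixed elements of $\pi$ (this does not mean $\pi(c_i)=c_i$), the others idle. Put $c_{k+1}=n+1$ and $[a_i]_\pi=\{x\in[n]:c_i\le\pi(x)<c_{i+1}\}$. $IP(n,k)$ denotes the set of these, $IP(n)=\bigcup_k IP(n,k)$; idempotent permutations with the same $A$ and the same sets $[a_i]_\pi$ are regarded as equivalent. The idempotent permutation $\pi\in IP(n,k)$ corresponds to $\iota\in I(n,k)$ if $A$ is the set of fixed points of $\iota$ and $[a_i]_\pi=[a_i]_\iota$ for all $i$ (so that $c_{i+1}-c_i=|[a_i]_\iota|$). The characteristic function $\varphi(x)=1$ if $x\in A$ and $0$ otherwise is "defined implicitly" when $\pi$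 is stored with fixed elements negated: the entry at $x$ is $-\pi(x)$ if $x\in A$ and $\pi(x)$ otherwise. "In-place" means the array $D[1\ldots n]$ initially holds $\iota$ and finally holds this signed version of $\pi$. Computation is on a unit-cost random access machine; "$\log n$ bits" means that amount of memory besides the array. -}

module Defs where

open import Algebra.Definitions using (IdempotentFun)
open import Data.Bool.Base using (Bool; if_then_else_)
open import Data.Fin.Base as Fin using (Fin; toℕ; fromℕ<)
open import Data.Fin.Permutation using (Permutation′; _⟨$⟩ʳ_)
open import Data.Fin.Properties as Fin using (any?)
open import Data.Integer.Base as ℤ using (ℤ; +_; ∣_∣)
open import Data.Nat.Base as ℕ using (ℕ; suc; _≤_; _<_; _^_)
open import Data.Nat.Properties using (_<?_)
open import Data.Product.Base using (_×_; _,_; ∃-syntax; proj₁; proj₂)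
open import Data.Vec.Functional using (Vector; foldr; updateAt)
open import Function.Base using (const)
open import Function.Bundles using (_⇔_)
open import Level using (0ℓ)
open import Relation.Binary.Core using (_Preserves_⟶_)
open import Relation.Binary.PropositionalEquality using (_≡_; refl)
open import Relation.Nullary.Decidable using (yes; no; ⌊_⌋)
open import Relation.Nullary.Negation using (¬_)
open import Relation.Unary using (Pred; _≐_)

-- The set [n] = {1, …, n} is Fin n; the number that x : Fin n stands for is
-- position x, and all order and arithmetic below uses these numbers.

position : ∀ {n} → Fin n → ℕ
position x = suc (toℕ x)

------------------------------------------------------------------------
-- Idempotent maps and idempotent permutations

record IdempotentMap (n : ℕ) : Set where
  field
    map        : Fin n → Fin n
    idempotent : IdempotentFun _≡_ map

record IdempotentPermutation (n k : ℕ) : Set where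
  field
    π            : Permutation′ n
    -- The distinguished set A, listed as a₁ < ⋯ < a_k.
    a            : Fin k → Fin n
    a-increasing : a Preserves Fin._<_ ⟶ Fin._<_

  c : Fin k → Fin n
  c i = π ⟨$⟩ʳ a i

  field
    1≤k          : 1 ≤ k
    c₁≡1         : position (c (fromℕ< 1≤k)) ≡ 1
    c-increasing : c Preserves Fin._<_ ⟶ Fin._<_

  -- c-next i is the number c_{i+1}, where c_{k+1} = n + 1.
  c-next : Fin k → ℕ
  c-next i with suc (toℕ i) <? k
  ... | yes i+1<k = position (c (fromℕ< i+1<k))
  ... | no  _     = suc n

  class : Fin k → Pred (Fin n) 0ℓ
  class i x = position (c i) ≤ position (π ⟨$⟩ʳ x)
            × position (π ⟨$⟩ʳ x) < c-next i

  φ : Fin n → Bool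
  φ x = ⌊ any? (λ i → a i Fin.≟ x) ⌋

  -- The stored form of π in which φ is implicit.
  signed : Fin n → ℤ
  signed x = if φ x then ℤ.- (+ position (π ⟨$⟩ʳ x))
                    else + position (π ⟨$⟩ʳ x)

-- The first condition makes the listing a of A the increasing listing of the
-- fixed points of ι, so k is also the cardinality of the image of ι.
Corresponds : ∀ {n k} → IdempotentPermutation n k → IdempotentMap n → Set
Corresponds p ι =
    (∀ x → (∃[ i ] a i ≡ x) ⇔ (map x ≡ x))
  × (∀ i → class i ≐ (λ x → map x ≡ a i))
  where
  open IdempotentPermutation p
  open IdempotentMap ι

------------------------------------------------------------------------
-- Unit-cost random access machine
--
-- Programs are structured (they compile to jump code of constant size).  The
-- data that survive from one statement to the next are the array D[1…n] and k
-- registers, register j having w j bits; intermediate values of the fixed,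
-- finitely many expressions of a program are not stored.

infix  8 D[_]
infixl 6 _⊕_ _⊖_
infix  4 _≺_ _≗_
infix  3 _≔_ D[_]≔_
infixr 2 _⨾_

data Expr (k : ℕ) : Set where
  lit     : ℤ → Expr k
  size    : Expr k                      -- the length n of the array
  reg     : Fin k → Expr k
  D[_]    : Expr k → Expr k
  _⊕_ _⊖_ : Expr k → Expr k → Expr k

data Test (k : ℕ) : Set where
  _≺_ _≗_ : Expr k → Expr k → Test k

data Stmt (k : ℕ) : Set where
  skip          : Stmt k
  _≔_           : Fin k → Expr k → Stmt k
  D[_]≔_        : Expr k → Expr k → Stmt k
  _⨾_           : Stmt k → Stmt k → Stmt k
  IF_THEN_ELSE_ : Test k → Stmt k → Stmt k → Stmt k
  WHILE_DO_     : Test k → Stmt k → Stmt k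

-- One unit for every constant, register access, array access, addition,
-- subtraction and comparison.

cost : ∀ {k} → Expr k → ℕ
cost (lit _) = 1
cost size    = 1
cost (reg _) = 1
cost D[ e ]  = suc (cost e)
cost (e ⊕ f) = suc (cost e ℕ.+ cost f)
cost (e ⊖ f) = suc (cost e ℕ.+ cost f)

testCost : ∀ {k} → Test k → ℕ
testCost (e ≺ f) = suc (cost e ℕ.+ cost f)
testCost (e ≗ f) = suc (cost e ℕ.+ cost f)

-- An array element, confined to [-n, n].
record Cell (n : ℕ) : Set where
  constructor cell
  field
    value    : ℤ
    .inRange : ∣ value ∣ ≤ n

open Cell public

Array : ℕ → Set
Array n = Vector (Cell n) n

Registers : ∀ {k} → Vector ℕ k → Set
Registers {k} w = (j : Fin k) → Fin (2 ^ w j)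

setReg : ∀ {k} (w : Vector ℕ k) → Registers w → (j : Fin k) → Fin (2 ^ w j) →
         Registers w
setReg w r j v i with i Fin.≟ j
... | yes refl = v
... | no  _    = r i

module Semantics (n : ℕ) {k : ℕ} (w : Vector ℕ k) where

  State : Set
  State = Array n × Registers w

  -- σ ⊢ e ⇓ z : in state σ, expression e has the value z.  An array access
  -- whose index is not in {1, …, n} has no value.
  infix 3 _⊢_⇓_
  data _⊢_⇓_ (σ : State) : Expr k → ℤ → Set where
    lit  : ∀ {z} → σ ⊢ lit z ⇓ z
    size : σ ⊢ size ⇓ + n
    reg  : ∀ {j} → σ ⊢ reg j ⇓ + toℕ (proj₂ σ j)
    get  : ∀ {e} {x : Fin n} → σ ⊢ e ⇓ + position x →
           σ ⊢ D[ e ] ⇓ value (proj₁ σ x)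
    add  : ∀ {e f y z} → σ ⊢ e ⇓ y → σ ⊢ f ⇓ z → σ ⊢ e ⊕ f ⇓ y ℤ.+ z
    sub  : ∀ {e f y z} → σ ⊢ e ⇓ y → σ ⊢ f ⇓ z → σ ⊢ e ⊖ f ⇓ y ℤ.- z

  infix 3 _⊨_ _⊭_
  data _⊨_ (σ : State) : Test k → Set where
    lt : ∀ {e f y z} → σ ⊢ e ⇓ y → σ ⊢ f ⇓ z → y ℤ.< z → σ ⊨ e ≺ f
    eq : ∀ {e f y z} → σ ⊢ e ⇓ y → σ ⊢ f ⇓ z → y ≡ z   → σ ⊨ e ≗ f

  data _⊭_ (σ : State) : Test k → Set where
    nlt : ∀ {e f y z} → σ ⊢ e ⇓ y → σ ⊢ f ⇓ z → ¬ (y ℤ.< z) → σ ⊭ e ≺ f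
    neq : ∀ {e f y z} → σ ⊢ e ⇓ y → σ ⊢ f ⇓ z → ¬ (y ≡ z)   → σ ⊭ e ≗ f

  -- Exec σ s t σ′ : started in σ, statement s halts in σ′ after t units of
  -- time.  A statement that would store a value outside [-n, n] in the array,
  -- or outside {0, …, 2 ^ w j - 1} in register j, does not halt.
  data Exec (σ : State) : Stmt k → ℕ → State → Set where
    skip     : Exec σ skip 1 σ
    setR     : ∀ {j e} (v : Fin (2 ^ w j)) → σ ⊢ e ⇓ + toℕ v →
               Exec σ (j ≔ e) (suc (cost e)) (proj₁ σ , setReg w (proj₂ σ) j v)
    setD     : ∀ {e f} (x : Fin n) (v : Cell n) →
               σ ⊢ e ⇓ + position x → σ ⊢ f ⇓ value v →
               Exec σ (D[ e ]≔ f) (suc (cost e ℕ.+ cost f))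
                    (updateAt (proj₁ σ) x (const v) , proj₂ σ)
    seq      : ∀ {s₁ s₂ t₁ t₂ σ₁ σ₂} → Exec σ s₁ t₁ σ₁ → Exec σ₁ s₂ t₂ σ₂ →
               Exec σ (s₁ ⨾ s₂) (t₁ ℕ.+ t₂) σ₂
    if-true  : ∀ {b s₁ s₂ t σ₁} → σ ⊨ b → Exec σ s₁ t σ₁ →
               Exec σ (IF b THEN s₁ ELSE s₂) (testCost b ℕ.+ t) σ₁
    if-false : ∀ {b s₁ s₂ t σ₁} → σ ⊭ b → Exec σ s₂ t σ₁ →
               Exec σ (IF b THEN s₁ ELSE s₂) (testCost b ℕ.+ t) σ₁
    loop     : ∀ {b s t₁ t₂ σ₁ σ₂} → σ ⊨ b →
               Exec σ s t₁ σ₁ → Exec σ₁ (WHILE b DO s) t₂ σ₂ →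
               Exec σ (WHILE b DO s) (testCost b ℕ.+ (t₁ ℕ.+ t₂)) σ₂
    exit     : ∀ {b s} → σ ⊭ b → Exec σ (WHILE b DO s) (testCost b) σ

open Semantics public using (Exec)

-- One program for all n; only the register widths depend on n.
record Algorithm : Set where
  field
    registers : ℕ
    width     : ℕ → Vector ℕ registers
    program   : Stmt registers

  additionalBits : ℕ → ℕ
  additionalBits n = foldr ℕ._+_ 0 (width n)

  Run : (n : ℕ) → Array n × Registers (width n) → ℕ →
        Array n × Registers (width n) → Set
  Run n σ t σ′ = Exec n (width n) σ program t σ′

store : ∀ {n} → IdempotentMap n → Array n
store ι x = cell (+ position (map x)) (Fin.toℕ<n (map x))
  where open IdempotentMap ι

{-# OPTIONS --safe #-}
module Submission where

-- The root of a class is its fixed point.  Write s(a) for the size of the class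
-- of the root a, and below(m) for the number of elements whose root lies below
-- m.  The corresponding permutation must send the root a to below(a) + 1 and the
-- idle elements of its class to the numbers below(a) + 2, ..., below(a) + s(a).
-- Giving out the latter in increasing order of the elements defines the
-- permutation, whose value at x is rank(x) + 1.  Within a class rank is injective,
-- and below(a) <= rank(x) < below(a) + s(a) for all x in the class of a; this
-- separates different classes and shows that the classes of the permutation are
-- those of the idempotent map.
--
-- The algorithm keeps one register, holding the index of the current element.
--
--   1. Every root is overwritten by 0, so that roots hold nonpositive numbers
--      and idle elements hold positive ones, namely pointers to their roots.
--   2. Every element subtracts 1 at its root, after which the root a holds
--      -s(a).
--   3. Prefix sums replace -s(a) by -(below(a) + s(a)).
--   4. In decreasing order, every idle element adds 1 at its root and takes the
--      absolute value of what it found there.  The root a ends up with -(below(a) + 1).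
--
-- The difficulty is step 3, which needs an accumulator besides the index.  It is
-- kept in the last cell, whose own content must not be lost.  Let l be the root
-- of the last element.  Then s(l) is n minus the sizes of all other classes, so
-- it need not be stored, and the cell of l can hold the sentinel -n instead.
-- A scan from the left, whose accumulator is minus the number of elements that
-- have not yet been accounted for, gives their sums to the roots below l
-- (forward-halts); a scan from the right, whose accumulator is defined in the
-- same way, gives theirs to the roots above l (sweep-halts).  Both scans go on as
-- long as the accumulator is smaller than the current cell.  This holds at idle
-- elements, where the cell is positive, and at roots other than l, where the
-- accumulator counts, negatively, the last element besides the class in question;
-- it fails at l.  When the scans have met at l, the accumulator is the value for
-- l, and the index in the register restores the pointer of the last element.  If
-- the last element is itself the root l, then the scan from the left does
-- everything, and the value for l is -n.

open import Defs
import Algebra.Properties.CommutativeMonoid.Sum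
open import Data.Bool.Base using (true; false; if_then_else_)
open import Data.Fin.Base as Fin using (Fin; zero; suc; toℕ; fromℕ; fromℕ<; punchOut)
open import Data.Fin.Permutation using (Permutation′; permutation; _⟨$⟩ʳ_)
import Data.Fin.Properties as Fin
open import Data.Integer.Base as ℤ using (ℤ; +_; -_; ∣_∣)
import Data.Integer.Properties as ℤ
open import Data.Integer.Tactic.RingSolver using (solve-∀)
open import Data.Nat.Base
open import Data.Nat.Induction using (<-rec)
open import Data.Nat.Logarithm
  using (⌈log₂_⌉; ⌈log₂⌈n/2⌉⌉≡⌈log₂n⌉∸1; ⌈log₂⌉-mono-≤)
import Data.Nat.Properties as ℕ
open import Data.Product.Base
open import Data.Sum.Base using (_⊎_; inj₁; inj₂; [_,_]′)
open import Data.Vec.Functional using (Vector)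
open import Data.Vec.Functional.Properties using (updateAt-updates; updateAt-minimal)
open import Function.Base using (_∘_)
open import Function.Bundles using (mk⇔)
open import Level using (0ℓ)
open import Relation.Binary.Definitions using (Tri; tri<; tri≈; tri>)
open import Relation.Binary.PropositionalEquality hiding (_≗_)
open import Relation.Nullary
open import Relation.Nullary.Decidable using (dec-true; dec-false; isYes≗does)
open import Relation.Unary using (Pred; Decidable; _⊆_)

------------------------------------------------------------------------
-- Counting in Fin n

private
  module Sum = Algebra.Properties.CommutativeMonoid.Sum ℕ.+-0-commutativeMonoid

-- A register of ⌈log₂ n⌉ bits can hold every index 0, …, n - 1.
n≤2^⌈log₂n⌉ : ∀ n → n ≤ 2 ^ ⌈log₂ n ⌉
n≤2^⌈log₂n⌉ = <-rec _ step
  where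
  open ℕ.≤-Reasoning
  step : ∀ n → (∀ {m} → m < n → m ≤ 2 ^ ⌈log₂ m ⌉) → n ≤ 2 ^ ⌈log₂ n ⌉
  step 0 _ = z≤n
  step 1 _ = s≤s z≤n
  step n@(suc (suc m)) rec = begin
    n                                  ≡⟨ ℕ.⌊n/2⌋+⌈n/2⌉≡n n ⟨
    ⌊ n /2⌋ + ⌈ n /2⌉                  ≤⟨ ℕ.+-mono-≤ (ℕ.⌊n/2⌋≤⌈n/2⌉ n) (ℕ.m≤m+n ⌈ n /2⌉ 0) ⟩
    2 * ⌈ n /2⌉                        ≤⟨ ℕ.*-monoʳ-≤ 2 (rec (ℕ.⌈n/2⌉<n m)) ⟩
    2 ^ suc ⌈log₂ ⌈ n /2⌉ ⌉            ≡⟨ cong (λ l → 2 ^ suc l) (⌈log₂⌈n/2⌉⌉≡⌈log₂n⌉∸1 n) ⟩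
    2 ^ suc (⌈log₂ n ⌉ ∸ 1)            ≡⟨ cong (2 ^_) (ℕ.m+[n∸m]≡n (⌈log₂⌉-mono-≤ {2} {n} (s≤s (s≤s z≤n)))) ⟩
    2 ^ ⌈log₂ n ⌉                      ∎

-- The number of elements that satisfy P.  It is opaque so that unification can
-- read off the predicate.
opaque
  count : ∀ {n} {P : Pred (Fin n) 0ℓ} → Decidable P → ℕ
  count P? = Sum.sum (λ z → if does (P? z) then 1 else 0)

  count-⊎ : ∀ {n} {P Q R : Pred (Fin n) 0ℓ}
            (P? : Decidable P) (Q? : Decidable Q) (R? : Decidable R) →
            (∀ z → P z → Q z ⊎ R z) → Q ⊆ P → R ⊆ P → (∀ z → Q z → ¬ R z) →
            count P? ≡ count Q? + count R?
  count-⊎ P? Q? R? P⊆Q⊎R Q⊆P R⊆P disjoint =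
    trans (Sum.sum-cong-≗ pointwise) (Sum.∑-distrib-+ (λ z → if does (Q? z) then 1 else 0) _)
    where
    pointwise : ∀ z → (if does (P? z) then 1 else 0) ≡
                (if does (Q? z) then 1 else 0) + (if does (R? z) then 1 else 0)
    pointwise z with P? z | Q? z | R? z
    ... | yes p | yes q | yes r = contradiction r (disjoint z q)
    ... | yes p | yes q | no ¬r = refl
    ... | yes p | no ¬q | yes r = refl
    ... | yes p | no ¬q | no ¬r = contradiction (P⊆Q⊎R z p) [ ¬q , ¬r ]′
    ... | no ¬p | yes q | _     = contradiction (Q⊆P q) ¬p
    ... | no ¬p | no ¬q | yes r = contradiction (R⊆P r) ¬p
    ... | no ¬p | no ¬q | no ¬r = refl

  count-none : ∀ {n} {P : Pred (Fin n) 0ℓ} (P? : Decidable P) → (∀ z → ¬ P z) → count P? ≡ 0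
  count-none {n} P? none =
    trans (Sum.sum-cong-≗ (λ z → cong (if_then 1 else 0) (dec-false (P? z) (none z))))
          (Sum.sum-replicate-zero n)

  count-all : ∀ {n} {P : Pred (Fin n) 0ℓ} (P? : Decidable P) → (∀ z → P z) → count P? ≡ n
  count-all {zero}  P? all = refl
  count-all {suc n} P? all =
    cong₂ (λ b k → (if b then 1 else 0) + k)
          (dec-true (P? zero) (all zero)) (count-all (P? ∘ suc) (all ∘ suc))

count-mono : ∀ {n} {P Q : Pred (Fin n) 0ℓ} (P? : Decidable P) (Q? : Decidable Q) →
             P ⊆ Q → count P? ≤ count Q?
count-mono {P = P} {Q} P? Q? P⊆Q =
  subst (count P? ≤_) (sym (count-⊎ Q? P? Q∖P? split P⊆Q proj₁ λ _ p q → proj₂ q p))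
        (ℕ.m≤m+n _ _)
  where
  Q∖P? : Decidable (λ z → Q z × ¬ P z)
  Q∖P? z = Q? z ×-dec ¬? (P? z)
  split : ∀ z → Q z → P z ⊎ (Q z × ¬ P z)
  split z q with P? z
  ... | yes p = inj₁ p
  ... | no ¬p = inj₂ (q , ¬p)

count-cong : ∀ {n} {P Q : Pred (Fin n) 0ℓ} (P? : Decidable P) (Q? : Decidable Q) →
             P ⊆ Q → Q ⊆ P → count P? ≡ count Q?
count-cong P? Q? P⊆Q Q⊆P = ℕ.≤-antisym (count-mono P? Q? P⊆Q) (count-mono Q? P? Q⊆P)

opaque
  unfolding count

  count-≟ : ∀ {n} (x : Fin n) → count (Fin._≟ x) ≡ 1
  count-≟ {suc n} zero = cong suc (count-none {n} (λ z → suc z Fin.≟ zero) λ _ ())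
  count-≟ (suc x) =
    trans (count-cong (λ z → suc z Fin.≟ suc x) (Fin._≟ x) Fin.suc-injective (cong suc))
          (count-≟ x)

module _ {n : ℕ} {P Q : Pred (Fin n) 0ℓ} (P? : Decidable P) (Q? : Decidable Q) where

  count-insert : ∀ x → P x → ¬ Q x → (∀ {z} → z ≢ x → P z → Q z) → Q ⊆ P →
                 count P? ≡ suc (count Q?)
  count-insert x px ¬qx P∖x⊆Q Q⊆P =
    trans (count-⊎ P? (Fin._≟ x) Q? split (λ where refl → px) Q⊆P λ where _ refl → ¬qx)
          (cong (_+ count Q?) (count-≟ x))
    where
    split : ∀ z → P z → z ≡ x ⊎ Q z
    split z pz with z Fin.≟ x
    ... | yes z≡x = inj₁ z≡x
    ... | no  z≢x = inj₂ (P∖x⊆Q z≢x pz)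

  count-mono-< : ∀ x → P ⊆ Q → ¬ P x → Q x → count P? < count Q?
  count-mono-< x P⊆Q ¬px qx = begin-strict
    count P?         <⟨ ℕ.n<1+n _ ⟩
    suc (count P?)   ≡⟨ count-insert-∪ ⟨
    count P∪x?       ≤⟨ count-mono P∪x? Q? (λ { (inj₁ p) → P⊆Q p ; (inj₂ refl) → qx }) ⟩
    count Q?         ∎
    where
    open ℕ.≤-Reasoning
    P∪x? : Decidable (λ z → P z ⊎ z ≡ x)
    P∪x? z = P? z ⊎-dec (z Fin.≟ x)
    count-insert-∪ : count P∪x? ≡ suc (count P?)
    count-insert-∪ = trans
      (count-⊎ P∪x? (Fin._≟ x) P? (λ { _ (inj₁ p) → inj₂ p ; _ (inj₂ e) → inj₁ e })
               inj₂ inj₁ λ { _ refl → ¬px })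
      (cong (_+ count P?) (count-≟ x))

-- The increasing list of the elements that satisfy P.
enumerate : ∀ {n} {P : Pred (Fin n) 0ℓ} (P? : Decidable P) →
            Σ[ k ∈ ℕ ] Σ[ a ∈ (Fin k → Fin n) ]
              ((∀ {i j} → i Fin.< j → a i Fin.< a j)
               × (∀ i → P (a i)) × (∀ x → P x → ∃[ i ] a i ≡ x))
enumerate {zero} P? = 0 , (λ ()) , (λ { {()} }) , (λ ()) , λ ()
enumerate {suc n} P? with enumerate (P? ∘ suc)
enumerate {suc n} {P} P? | k , a , a-inc , sound , complete with P? zero
... | yes p = suc k , a⁺ , inc , sound⁺ , complete⁺
  where
  a⁺ : Fin (suc k) → Fin (suc n)
  a⁺ zero    = zero
  a⁺ (suc i) = suc (a i)
  inc : ∀ {i j} → i Fin.< j → a⁺ i Fin.< a⁺ j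
  inc {zero}  {suc j} _         = s≤s z≤n
  inc {suc i} {suc j} (s≤s i<j) = s≤s (a-inc i<j)
  sound⁺ : ∀ i → P (a⁺ i)
  sound⁺ zero    = p
  sound⁺ (suc i) = sound i
  complete⁺ : ∀ x → P x → ∃[ i ] a⁺ i ≡ x
  complete⁺ zero    _  = zero , refl
  complete⁺ (suc x) px = map suc (cong suc) (complete x px)
... | no ¬p = k , suc ∘ a , (λ i<j → s≤s (a-inc i<j)) , sound , complete⁺
  where
  complete⁺ : ∀ x → P x → ∃[ i ] suc (a i) ≡ x
  complete⁺ zero    px = contradiction px ¬p
  complete⁺ (suc x) px = map₂ (cong suc) (complete x px)

injective⇒surjective : ∀ {n} (f : Fin n → Fin n) → (∀ {x y} → f x ≡ f y → x ≡ y) →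
                       ∀ y → ∃[ x ] f x ≡ y
injective⇒surjective {suc n} f inj y with Fin.any? (λ x → f x Fin.≟ y)
... | yes hit = hit
... | no miss = contradiction
  (Fin.injective⇒≤ {f = λ x → punchOut (avoids x)} λ e → inj (Fin.punchOut-injective (avoids _) (avoids _) e))
  ℕ.1+n≰n
  where
  avoids : ∀ x → y ≢ f x
  avoids x y≡fx = miss (x , sym y≡fx)

------------------------------------------------------------------------
-- The permutation of an idempotent map

module Ranking {n : ℕ} (ι : IdempotentMap n) where
  open IdempotentMap ι renaming (map to μ) public

  -- The fixed points; the other elements are idle.
  Root : Fin n → Set
  Root y = μ y ≡ y

  root? : Decidable Root
  root? y = μ y Fin.≟ y

  opaque
    -- The size of the class of y; it is 0 unless y is a root.
    fibre : Fin n → ℕ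
    fibre y = count (λ z → μ z Fin.≟ y)

    -- The number of elements whose root has an index less than m.
    below : ℕ → ℕ
    below m = count (λ z → toℕ (μ z) ℕ.<? m)

    -- The number of elements whose root has an index at least m.
    above : ℕ → ℕ
    above m = count (λ z → m ℕ.≤? toℕ (μ z))

    tally? : ∀ m y → Decidable (λ z → m ≤ toℕ z × μ z ≡ y)
    tally? m y z = (m ℕ.≤? toℕ z) ×-dec (μ z Fin.≟ y)

    -- The number of elements of index at least m whose root is y.
    tally : ℕ → Fin n → ℕ
    tally m y = count (tally? m y)

    -- z is an idle element of index less than m, and its root is y.
    IdleBelow : ℕ → Fin n → Fin n → Set
    IdleBelow m y z = toℕ z < m × ¬ Root z × μ z ≡ y

    idleBelow? : ∀ m y → Decidable (IdleBelow m y)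
    idleBelow? m y z = (toℕ z ℕ.<? m) ×-dec ¬? (root? z) ×-dec (μ z Fin.≟ y)

    -- The number of such elements.
    idleBelow : ℕ → Fin n → ℕ
    idleBelow m y = count (idleBelow? m y)

    below-suc : ∀ x → below (suc (toℕ x)) ≡ below (toℕ x) + fibre x
    below-suc x = count-⊎ _ _ _
      (λ z z≤x → [ inj₁ , (λ e → inj₂ (Fin.toℕ-injective e)) ]′ (ℕ.m≤n⇒m<n∨m≡n (s≤s⁻¹ z≤x)))
      ℕ.m<n⇒m<1+n (λ { refl → ℕ.≤-refl }) λ { z z<x refl → ℕ.<-irrefl refl z<x }

    below-mono : ∀ {l m} → l ≤ m → below l ≤ below m
    below-mono l≤m = count-mono _ _ λ z<l → ℕ.<-≤-trans z<l l≤m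

    below-top : ∀ {m} → n ≤ m → below m ≡ n
    below-top n≤m = count-all _ λ z → ℕ.<-≤-trans (Fin.toℕ<n (μ z)) n≤m

    below-none : ∀ {m} → (∀ z → m ≤ toℕ (μ z)) → below m ≡ 0
    below-none m≤μ = count-none _ λ z → ℕ.≤⇒≯ (m≤μ z)

    below≤n : ∀ m → below m ≤ n
    below≤n m = subst (below m ≤_) (count-all (λ _ → yes refl) λ _ → refl {x = n})
                      (count-mono {P = λ z → toℕ (μ z) < m} _ _ λ _ → refl)

    below-root : ∀ {y} → Root y → below (toℕ y) < below (suc (toℕ y))
    below-root {y} root = count-mono-< _ _ y ℕ.m<n⇒m<1+n (ℕ.≤⇒≯ (ℕ.≤-reflexive (sym (cong toℕ root))))
      (ℕ.≤-reflexive (cong (suc ∘ toℕ) root))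

    below-pos : ∀ {m} y → toℕ (μ y) < m → 0 < below m
    below-pos {m} y μy<m = subst (_≤ below m) (count-≟ y) (count-mono _ _ λ { refl → μy<m })

    above-suc : ∀ x → above (toℕ x) ≡ fibre x + above (suc (toℕ x))
    above-suc x = count-⊎ _ _ _
      (λ z x≤μz → [ inj₂ , (λ e → inj₁ (sym (Fin.toℕ-injective e))) ]′ (ℕ.m≤n⇒m<n∨m≡n x≤μz))
      (λ { refl → ℕ.≤-refl }) ℕ.<⇒≤ λ { z refl μz<μz → ℕ.<-irrefl refl μz<μz }

    below+above : ∀ m → below m + above m ≡ n
    below+above m = trans
      (sym (count-⊎ (λ _ → yes refl) _ _ (λ z _ → ℕ.<-≤-connex (toℕ (μ z)) m) (λ _ → refl {x = n}) (λ _ → refl)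
             λ z → ℕ.<⇒≱))
      (count-all _ λ _ → refl)

    above≤n : ∀ m → above m ≤ n
    above≤n m = subst (above m ≤_) (below+above m) (ℕ.m≤n+m (above m) (below m))

    above-bottom : above 0 ≡ n
    above-bottom = count-all _ λ _ → z≤n

    above-pos : ∀ {m} y → m ≤ toℕ (μ y) → 0 < above m
    above-pos {m} y m≤μy = subst (_≤ above m) (count-≟ y) (count-mono _ _ λ { refl → m≤μy })

    tally≤n : ∀ m y → tally m y ≤ n
    tally≤n m y = subst (tally m y ≤_) (count-all (λ _ → yes refl) λ _ → refl {x = n})
                        (count-mono {P = λ z → m ≤ toℕ z × μ z ≡ y} _ _ λ _ → refl)

    tally-top : ∀ y → tally n y ≡ 0
    tally-top y = count-none _ λ z (n≤z , _) → ℕ.≤⇒≯ n≤z (Fin.toℕ<n z)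

    tally-bottom : ∀ y → tally 0 y ≡ fibre y
    tally-bottom y = count-cong _ _ proj₂ (z≤n ,_)

    tally-hit : ∀ x → tally (toℕ x) (μ x) ≡ suc (tally (suc (toℕ x)) (μ x))
    tally-hit x = count-insert _ _ x (ℕ.≤-refl , refl) (λ (x<x , _) → ℕ.<-irrefl refl x<x)
      (λ z≢x (x≤z , μz≡) → ℕ.≤∧≢⇒< x≤z (λ e → z≢x (sym (Fin.toℕ-injective e))) , μz≡)
      (map₁ ℕ.<⇒≤)

    tally-miss : ∀ x {y} → y ≢ μ x → tally (toℕ x) y ≡ tally (suc (toℕ x)) y
    tally-miss x y≢μx = count-cong _ _
      (λ (x≤z , μz≡y) → ℕ.≤∧≢⇒< x≤z
        (λ e → y≢μx (trans (sym μz≡y) (cong μ (sym (Fin.toℕ-injective e))))) , μz≡y)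
      (map₁ ℕ.<⇒≤)

    idleBelow-bottom : ∀ y → idleBelow 0 y ≡ 0
    idleBelow-bottom y = count-none _ λ { z (() , _) }

    idleBelow-hit : ∀ {x} → ¬ Root x → idleBelow (suc (toℕ x)) (μ x) ≡ suc (idleBelow (toℕ x) (μ x))
    idleBelow-hit {x} idle = count-insert _ _ x (ℕ.≤-refl , idle , refl) (λ (x<x , _) → ℕ.<-irrefl refl x<x)
      (λ z≢x (z≤x , rest) → ℕ.≤∧≢⇒< (s≤s⁻¹ z≤x) (z≢x ∘ Fin.toℕ-injective) , rest)
      (map₁ ℕ.m<n⇒m<1+n)

    idleBelow-miss : ∀ x {y} → (¬ Root x → y ≢ μ x) → idleBelow (suc (toℕ x)) y ≡ idleBelow (toℕ x) y
    idleBelow-miss x {y} miss = count-cong _ _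
      (λ (z≤x , idle , μz≡y) → ℕ.≤∧≢⇒< (s≤s⁻¹ z≤x) (λ e → z≢x μz≡y idle (Fin.toℕ-injective e)) , idle , μz≡y)
      (map₁ ℕ.m<n⇒m<1+n)
      where
      z≢x : ∀ {z} → μ z ≡ y → ¬ Root z → z ≢ x
      z≢x μz≡y idle refl = miss idle (sym μz≡y)

    idleBelow-< : ∀ {x m} → ¬ Root x → toℕ x < m → idleBelow (toℕ x) (μ x) < idleBelow m (μ x)
    idleBelow-< {x} idle x<m = count-mono-< _ _ x (map₁ λ z<x → ℕ.<-trans z<x x<m)
      (λ (x<x , _) → ℕ.<-irrefl refl x<x) (x<m , idle , refl)

    fibre-idle : ∀ {y} → ¬ Root y → fibre y ≡ 0
    fibre-idle idle = count-none _ λ { z refl → idle (idempotent z) }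

    fibre-root : ∀ {y} → Root y → fibre y ≡ suc (idleBelow n y)
    fibre-root {y} root = count-insert _ _ y root (λ (_ , idle , _) → idle root)
      (λ { {z} z≢y refl → Fin.toℕ<n z , z≢y ∘ sym , refl })
      (λ (_ , _ , μz≡y) → μz≡y)

    fibre-pos : ∀ {y} → Root y → 0 < fibre y
    fibre-pos root = subst (0 <_) (sym (fibre-root root)) z<s

    below-suc-root : ∀ {y} → Root y → below (suc (toℕ y)) ≡ suc (below (toℕ y) + idleBelow n y)
    below-suc-root {y} root =
      trans (below-suc y) (trans (cong (λ s → below (toℕ y) + s) (fibre-root root)) (ℕ.+-suc _ _))

    -- The value of the permutation at y, less 1: a root comes first in its class,
    -- and the idle elements follow in increasing order.
    rank : Fin n → ℕ
    rank y = if does (root? y) then below (toℕ y) else suc (below (toℕ (μ y)) + idleBelow (toℕ y) (μ y))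

    rank-root : ∀ {y} → Root y → rank y ≡ below (toℕ y)
    rank-root {y} root with root? y
    ... | yes _   = refl
    ... | no idle = contradiction root idle

    rank-idle : ∀ {y} → ¬ Root y → rank y ≡ suc (below (toℕ (μ y)) + idleBelow (toℕ y) (μ y))
    rank-idle {y} idle with root? y
    ... | yes root = contradiction root idle
    ... | no _     = refl

    below≤rank : ∀ y → below (toℕ (μ y)) ≤ rank y
    below≤rank y with root? y
    ... | yes root = ℕ.≤-reflexive (cong (below ∘ toℕ) root)
    ... | no  idle = ℕ.m≤n⇒m≤1+n (ℕ.m≤m+n _ _)

    rank<below : ∀ y → rank y < below (suc (toℕ (μ y)))
    rank<below y with root? y
    ... | yes root = subst (λ x → below (toℕ y) < below (suc (toℕ x))) (sym root) (below-root root)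
    ... | no  idle = subst (suc (below (toℕ (μ y)) + idleBelow (toℕ y) (μ y)) <_)
                       (sym (below-suc-root (idempotent y)))
                       (s≤s (ℕ.+-monoʳ-< (below (toℕ (μ y))) (idleBelow-< idle (Fin.toℕ<n y))))

    rank-mono : ∀ {x y} → μ x Fin.< μ y → rank x < rank y
    rank-mono {x} {y} lt = ℕ.<-≤-trans (rank<below x) (ℕ.≤-trans (below-mono lt) (below≤rank y))

    rank-mono-idle : ∀ {x y} → ¬ Root x → ¬ Root y → μ x ≡ μ y → x Fin.< y → rank x < rank y
    rank-mono-idle {x} {y} idle-x idle-y μx≡μy x<y = begin-strict
      rank x                                                ≡⟨ rank-idle idle-x ⟩
      suc (below (toℕ (μ x)) + idleBelow (toℕ x) (μ x))     <⟨ s≤s (ℕ.+-monoʳ-< _ (idleBelow-< idle-x x<y)) ⟩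
      suc (below (toℕ (μ x)) + idleBelow (toℕ y) (μ x))
        ≡⟨ cong (λ a → suc (below (toℕ a) + idleBelow (toℕ y) a)) μx≡μy ⟩
      suc (below (toℕ (μ y)) + idleBelow (toℕ y) (μ y))     ≡⟨ rank-idle idle-y ⟨
      rank y                                                ∎
      where open ℕ.≤-Reasoning

    rank-root-idle : ∀ {x y} → Root x → ¬ Root y → μ x ≡ μ y → rank x < rank y
    rank-root-idle {x} {y} root idle μx≡μy = subst₂ _<_ (sym (rank-root root)) (sym (rank-idle idle))
      (s≤s (ℕ.≤-trans (ℕ.≤-reflexive (cong (below ∘ toℕ) (trans (sym root) μx≡μy))) (ℕ.m≤m+n _ _)))

    -- The case of two elements of the same class.
    rank-injective-within : ∀ {x y} → Dec (Root x) → Dec (Root y) → μ x ≡ μ y → rank x ≡ rank y → x ≡ y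
    rank-injective-within (yes root-x) (yes root-y) μx≡μy _ = trans (sym root-x) (trans μx≡μy root-y)
    rank-injective-within (yes root-x) (no idle-y)  μx≡μy r≡ =
      contradiction r≡ (ℕ.<⇒≢ (rank-root-idle root-x idle-y μx≡μy))
    rank-injective-within (no idle-x)  (yes root-y) μx≡μy r≡ =
      contradiction (sym r≡) (ℕ.<⇒≢ (rank-root-idle root-y idle-x (sym μx≡μy)))
    rank-injective-within {x} {y} (no idle-x) (no idle-y) μx≡μy r≡ with Fin.<-cmp x y
    ... | tri< x<y _ _ = contradiction r≡ (ℕ.<⇒≢ (rank-mono-idle idle-x idle-y μx≡μy x<y))
    ... | tri≈ _ x≡y _ = x≡y
    ... | tri> _ _ y<x = contradiction (sym r≡) (ℕ.<⇒≢ (rank-mono-idle idle-y idle-x (sym μx≡μy) y<x))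

    rank-injective : ∀ {x y} → rank x ≡ rank y → x ≡ y
    rank-injective {x} {y} r≡ with Fin.<-cmp (μ x) (μ y)
    ... | tri< μx<μy _ _ = contradiction r≡ (ℕ.<⇒≢ (rank-mono μx<μy))
    ... | tri≈ _ μx≡μy _ = rank-injective-within (root? x) (root? y) μx≡μy r≡
    ... | tri> _ _ μy<μx = contradiction (sym r≡) (ℕ.<⇒≢ (rank-mono μy<μx))

  rank<n : ∀ y → rank y < n
  rank<n y = ℕ.<-≤-trans (rank<below y) (below≤n _)

  rankFin : Fin n → Fin n
  rankFin y = fromℕ< (rank<n y)

  toℕ-rankFin : ∀ y → toℕ (rankFin y) ≡ rank y
  toℕ-rankFin y = Fin.toℕ-fromℕ< (rank<n y)

  rankFin-injective : ∀ {x y} → rankFin x ≡ rankFin y → x ≡ y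
  rankFin-injective {x} {y} eq = rank-injective
    (trans (sym (toℕ-rankFin x)) (trans (cong toℕ eq) (toℕ-rankFin y)))

  rankPermutation : Permutation′ n
  rankPermutation = permutation rankFin (proj₁ ∘ preimage) (proj₂ ∘ preimage)
    λ x → rankFin-injective (proj₂ (preimage (rankFin x)))
    where preimage = injective⇒surjective rankFin rankFin-injective

module Corresponding {n : ℕ} (ι : IdempotentMap (suc n)) where
  open Ranking ι

  roots : Σ[ k ∈ ℕ ] Σ[ a ∈ (Fin k → Fin (suc n)) ]
            ((∀ {i j} → i Fin.< j → a i Fin.< a j)
             × (∀ i → Root (a i)) × (∀ x → Root x → ∃[ i ] a i ≡ x))
  roots = enumerate root?

  k : ℕ
  k = proj₁ roots

  a : Fin k → Fin (suc n)
  a = proj₁ (proj₂ roots)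

  a-inc : ∀ {i j} → i Fin.< j → a i Fin.< a j
  a-inc = proj₁ (proj₂ (proj₂ roots))

  a-root : ∀ i → Root (a i)
  a-root = proj₁ (proj₂ (proj₂ (proj₂ roots)))

  index : ∀ x → Root x → ∃[ i ] a i ≡ x
  index = proj₂ (proj₂ (proj₂ (proj₂ roots)))

  1≤k : 1 ≤ k
  1≤k = ℕ.≤-<-trans z≤n (Fin.toℕ<n (proj₁ (index (μ zero) (idempotent zero))))

  a-inc⁻ : ∀ {i j} → a i Fin.< a j → i Fin.< j
  a-inc⁻ {i} {j} lt with Fin.<-cmp i j
  ... | tri< i<j _ _  = i<j
  ... | tri≈ _ refl _ = contradiction lt (ℕ.<-irrefl refl)
  ... | tri> _ _ j<i  = contradiction (a-inc j<i) (ℕ.<-asym lt)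

  -- The idempotent permutation with values rank y + 1.
  permutationOf : IdempotentPermutation (suc n) k
  permutationOf = record
    { π            = rankPermutation
    ; a            = a
    ; a-increasing = a-inc
    ; 1≤k          = 1≤k
    ; c₁≡1         = cong suc (trans (toℕ-rankFin _) (trans (rank-root (a-root _)) (below-none first)))
    ; c-increasing = λ {i} {j} i<j → subst₂ _<_ (sym (toℕ-rankFin (a i))) (sym (toℕ-rankFin (a j)))
        (rank-mono (subst₂ Fin._<_ (sym (a-root i)) (sym (a-root j)) (a-inc i<j)))
    }
    where
    -- The root of z is some aᵢ, which is not below the first one.
    first : ∀ z → a (fromℕ< 1≤k) Fin.≤ μ z
    first z = ℕ.≮⇒≥ λ μz<a₁ → let i , aᵢ≡μz = index (μ z) (idempotent z) in
      ℕ.n≮0 (subst (toℕ i <_) (Fin.toℕ-fromℕ< 1≤k) (a-inc⁻ (subst (Fin._< _) (sym aᵢ≡μz) μz<a₁)))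

  open IdempotentPermutation permutationOf using (π; c; c-next; class; φ; signed)

  rank≤⇒ : ∀ {x y} → rank x ≤ rank y → μ x Fin.≤ μ y
  rank≤⇒ r≤ = ℕ.≮⇒≥ λ lt → ℕ.<⇒≱ (rank-mono lt) r≤

  rank-root≤ : ∀ {x y} → Root x → x Fin.≤ μ y → rank x ≤ rank y
  rank-root≤ {x} {y} root x≤μy = begin
    rank x              ≡⟨ rank-root root ⟩
    below (toℕ x)       ≤⟨ below-mono x≤μy ⟩
    below (toℕ (μ y))   ≤⟨ below≤rank y ⟩
    rank y              ∎
    where open ℕ.≤-Reasoning

  -- An index j > i would put the root of x, and hence c_{i+1}, at or below the
  -- value at x; an index j < i would make the value at x less than cᵢ.
  class⇒ : ∀ {i x} → class i x → μ x ≡ a i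
  class⇒ {i} {x} (cᵢ≤πx , πx<c⁺) with index (μ x) (idempotent x)
  ... | j , aⱼ≡μx with Fin.<-cmp i j
  ...   | tri≈ _ refl _ = sym aⱼ≡μx
  ...   | tri> _ _ j<i = contradiction
    (subst₂ Fin._≤_ (a-root i) (sym aⱼ≡μx)
      (rank≤⇒ (subst₂ _≤_ (toℕ-rankFin (a i)) (toℕ-rankFin x) (s≤s⁻¹ cᵢ≤πx))))
    (ℕ.<⇒≱ (a-inc j<i))
  ...   | tri< i<j _ _ with suc (toℕ i) ℕ.<? k
  ...     | no i+1≮k = contradiction (ℕ.≤-<-trans i<j (Fin.toℕ<n j)) i+1≮k
  ...     | yes i+1<k = contradiction
    (rank-root≤ (a-root _) (subst (a (fromℕ< i+1<k) Fin.≤_) aⱼ≡μx a⁺≤aⱼ))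
    (ℕ.<⇒≱ (subst₂ _<_ (toℕ-rankFin x) (toℕ-rankFin _) (s<s⁻¹ πx<c⁺)))
    where
    a⁺≤aⱼ : a (fromℕ< i+1<k) Fin.≤ a j
    a⁺≤aⱼ = ℕ.≮⇒≥ λ lt → ℕ.<⇒≱ (subst (toℕ j <_) (Fin.toℕ-fromℕ< i+1<k) (a-inc⁻ lt)) i<j

  class⇐ : ∀ {i x} → μ x ≡ a i → class i x
  class⇐ {i} {x} μx≡aᵢ =
    s≤s (subst₂ _≤_ (sym (toℕ-rankFin (a i))) (sym (toℕ-rankFin x))
      (rank-root≤ (a-root i) (ℕ.≤-reflexive (cong toℕ (sym μx≡aᵢ))))) , upper
    where
    upper : position (π ⟨$⟩ʳ x) < c-next i
    upper with suc (toℕ i) ℕ.<? k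
    ... | no  _     = s<s (Fin.toℕ<n _)
    ... | yes i+1<k = s<s (subst₂ _<_ (sym (toℕ-rankFin x)) (sym (toℕ-rankFin _))
      (rank-mono (subst₂ Fin._<_ (sym μx≡aᵢ) (sym (a-root _))
        (a-inc (subst (toℕ i <_) (sym (Fin.toℕ-fromℕ< i+1<k)) ℕ.≤-refl)))))

  corresponds : Corresponds permutationOf ι
  corresponds = (λ x → mk⇔ (λ { (i , refl) → a-root i }) (index x)) , λ i → class⇒ , class⇐

  signed-root : ∀ {x} → Root x → signed x ≡ - (+ suc (below (toℕ x)))
  signed-root {x} root = trans
    (cong (if_then - (+ position (rankFin x)) else + position (rankFin x)) φx)
    (cong (λ r → - (+ suc r)) (trans (toℕ-rankFin x) (rank-root root)))
    where
    φx : φ x ≡ true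
    φx = trans (isYes≗does _) (dec-true (Fin.any? λ i → a i Fin.≟ x) (index x root))

  signed-idle : ∀ {x} → ¬ Root x → signed x ≡ + suc (rank x)
  signed-idle {x} idle = trans
    (cong (if_then - (+ position (rankFin x)) else + position (rankFin x)) φx)
    (cong (λ r → + suc r) (toℕ-rankFin x))
    where
    φx : φ x ≡ false
    φx = trans (isYes≗does _) (dec-false (Fin.any? λ i → a i Fin.≟ x) λ { (i , refl) → idle (a-root i) })

------------------------------------------------------------------------
-- Programs and their execution

-- There is one register, of ⌈log₂ n⌉ bits.
width : ℕ → Vector ℕ 1
width n _ = ⌈log₂ n ⌉

-- The register holds an index from 0, and here is the corresponding position.
X here : Expr 1
X    = reg zero
here = X ⊕ lit (+ 1)

-- Runs body with the register at n - 1, …, 0.  The first round precedes the loop,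
-- so that the register never has to leave this range.
downwards : Stmt 1 → Stmt 1
downwards body =
  zero ≔ size ⊖ lit (+ 1) ⨾
  body ⨾
  WHILE lit (+ 0) ≺ X DO (zero ≔ X ⊖ lit (+ 1) ⨾ body)

module Logic (n : ℕ) where
  open Semantics n (width n) hiding (Exec) public

  contents : State → Fin n → ℤ
  contents σ y = value (proj₁ σ y)

  -- The register holds the index of x.
  infix 4 _at_
  _at_ : State → Fin n → Set
  σ at x = toℕ (proj₂ σ zero) ≡ toℕ x

  -- Started in σ, the statement s halts within time T in a state satisfying Q.
  Halts : State → Stmt 1 → ℕ → (State → Set) → Set
  Halts σ s T Q = ∃[ σ′ ] ∃[ t ] Exec n (width n) σ s t σ′ × t ≤ T × Q σ′

  module _ {σ : State} where

    -- Replaces the value of an expression by an equal one.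
    as : ∀ {e y z} → y ≡ z → σ ⊢ e ⇓ y → σ ⊢ e ⇓ z
    as refl d = d

    skip-halts : ∀ {Q} → Q σ → Halts σ skip 1 Q
    skip-halts q = σ , 1 , skip , ℕ.≤-refl , q

    seq-halts : ∀ {s₁ s₂ T₁ T₂ Q} → Halts σ s₁ T₁ (λ σ₁ → Halts σ₁ s₂ T₂ Q) →
                Halts σ (s₁ ⨾ s₂) (T₁ + T₂) Q
    seq-halts (_ , _ , ex₁ , t₁≤ , _ , _ , ex₂ , t₂≤ , q) =
      _ , _ , seq ex₁ ex₂ , ℕ.+-mono-≤ t₁≤ t₂≤ , q

    then-halts : ∀ {b s₁ s₂ T Q} → σ ⊨ b → Halts σ s₁ T Q →
                 Halts σ (IF b THEN s₁ ELSE s₂) (testCost b + T) Q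
    then-halts {b} yes-b (_ , _ , ex , t≤ , q) =
      _ , _ , if-true yes-b ex , ℕ.+-monoʳ-≤ (testCost b) t≤ , q

    else-halts : ∀ {b s₁ s₂ T Q} → σ ⊭ b → Halts σ s₂ T Q →
                 Halts σ (IF b THEN s₁ ELSE s₂) (testCost b + T) Q
    else-halts {b} no-b (_ , _ , ex , t≤ , q) =
      _ , _ , if-false no-b ex , ℕ.+-monoʳ-≤ (testCost b) t≤ , q

    weaken : ∀ {s T Q R} → Halts σ s T Q → (∀ σ′ → Q σ′ → R σ′) → Halts σ s T R
    weaken (_ , _ , ex , t≤ , q) imp = _ , _ , ex , t≤ , imp _ q

    within : ∀ {s T T′ Q} → T ≤ T′ → Halts σ s T Q → Halts σ s T′ Q
    within T≤T′ (_ , _ , ex , t≤ , q) = _ , _ , ex , ℕ.≤-trans t≤ T≤T′ , q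

    -- The rules for assignments take what is to be shown of the resulting state as a
    -- continuation.
    move-halts : ∀ {e Q} (x : Fin n) → σ ⊢ e ⇓ + toℕ x →
                 (∀ σ′ → σ′ at x → contents σ′ ≡ contents σ → Q σ′) →
                 Halts σ (zero ≔ e) (suc (cost e)) Q
    move-halts x d k = _ , _ , setR v (as (cong +_ (sym toℕ-v)) d) , ℕ.≤-refl , k _ toℕ-v refl
      where
      x<2^w : toℕ x < 2 ^ ⌈log₂ n ⌉
      x<2^w = ℕ.<-≤-trans (Fin.toℕ<n x) (n≤2^⌈log₂n⌉ n)
      v = fromℕ< x<2^w
      toℕ-v : toℕ v ≡ toℕ x
      toℕ-v = Fin.toℕ-fromℕ< x<2^w

    write-halts : ∀ {e f Q} (x y : Fin n) (z : ℤ) → σ at x →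
                  σ ⊢ e ⇓ + position y → σ ⊢ f ⇓ z → ∣ z ∣ ≤ n →
                  (∀ σ′ → σ′ at x → contents σ′ y ≡ z →
                    (∀ u → u ≢ y → contents σ′ u ≡ contents σ u) → Q σ′) →
                  Halts σ (D[ e ]≔ f) (suc (cost e + cost f)) Q
    write-halts x y z at-x d₁ d₂ z-fits k =
      _ , _ , setD y (cell z z-fits) d₁ d₂ , ℕ.≤-refl ,
      k _ at-x (cong value (updateAt-updates y (proj₁ σ)))
        (λ u u≢y → cong value (updateAt-minimal u y (proj₁ σ) u≢y))

    here-⇓ : ∀ {x} → σ at x → σ ⊢ here ⇓ + position x
    here-⇓ {x} at-x = as (cong +_ (trans (ℕ.+-comm _ 1) (cong suc at-x))) (add reg lit)

    get-⇓ : ∀ {e y z} → σ ⊢ e ⇓ + position y → contents σ y ≡ z → σ ⊢ D[ e ] ⇓ z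
    get-⇓ d v≡z = as v≡z (get d)

    size-⇓ : ∀ {y : Fin n} → position y ≡ n → σ ⊢ size ⇓ + position y
    size-⇓ y≡n = as (cong +_ (sym y≡n)) size

    then-≺ : ∀ {e f s₁ s₂ T Q y z} → σ ⊢ e ⇓ y → σ ⊢ f ⇓ z → y ℤ.< z → Halts σ s₁ T Q →
             Halts σ (IF e ≺ f THEN s₁ ELSE s₂) (suc (cost e + cost f) + T) Q
    then-≺ d₁ d₂ y<z = then-halts (lt d₁ d₂ y<z)

    else-≺ : ∀ {e f s₁ s₂ T Q y z} → σ ⊢ e ⇓ y → σ ⊢ f ⇓ z → ¬ y ℤ.< z → Halts σ s₂ T Q →
             Halts σ (IF e ≺ f THEN s₁ ELSE s₂) (suc (cost e + cost f) + T) Q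
    else-≺ d₁ d₂ y≮z = else-halts (nlt d₁ d₂ y≮z)

  -- P k holds whenever k rounds are still to come.
  while-halts : ∀ {b s T} (P : ℕ → State → Set) →
                (∀ {σ j} → P (suc j) σ → σ ⊨ b × Halts σ s T (P j)) →
                (∀ {σ} → P 0 σ → σ ⊭ b) →
                ∀ j {σ} → P j σ → Halts σ (WHILE b DO s) (suc j * (testCost b + T)) (P 0)
  while-halts {b} {T = T} P step stop zero p = _ , _ , exit (stop p) ,
    ℕ.≤-trans (ℕ.m≤m+n (testCost b) T) (ℕ.m≤m+n _ 0) , p
  while-halts {b} {T = T} P step stop (suc j) p with step p
  ... | yes-b , _ , _ , ex , t≤ , p′ with while-halts P step stop j p′
  ... | _ , _ , ex′ , t′≤ , q =
    _ , _ , loop yes-b ex ex′ ,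
    ℕ.≤-trans (ℕ.+-monoʳ-≤ (testCost b) (ℕ.+-mono-≤ t≤ t′≤))
               (ℕ.≤-reflexive (sym (ℕ.+-assoc (testCost b) T _))) , q

  -- I j describes the array when the elements of index at least j have been
  -- processed.
  downwards-halts : ∀ {body T} (I : ℕ → (Fin n → ℤ) → Set) → .{{_ : NonZero n}} →
    (∀ {σ} x → σ at x → I (suc (toℕ x)) (contents σ) →
      Halts σ body T (λ σ′ → σ′ at x × I (toℕ x) (contents σ′))) →
    ∀ {σ} → I n (contents σ) →
    Halts σ (downwards body) ((11 + (T + T)) * n) (I 0 ∘ contents)
  downwards-halts {body} {T} I run {σ} i =
    within bound
      (seq-halts (move-halts last size-1⇓ λ σ₁ at-last same →
       seq-halts (weaken (run last at-last (subst₂ I (sym last≡n) (sym same) i))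
       λ σ₂ → λ where
         (at-last , i₂) → weaken (while-halts P step stop (toℕ last) (last , at-last , refl , i₂))
            λ _ (_ , _ , _ , i₃) → i₃)))
    where
    P : ℕ → State → Set
    P j σ = ∃[ x ] σ at x × toℕ x ≡ j × I j (contents σ)
    last : Fin n
    last = fromℕ< (ℕ.≤-reflexive (ℕ.suc-pred n))
    last≡n : position last ≡ n
    last≡n = trans (cong suc (Fin.toℕ-fromℕ< _)) (ℕ.suc-pred n)
    size-1⇓ : σ ⊢ size ⊖ lit (+ 1) ⇓ + toℕ last
    size-1⇓ = as (cong (λ k → + k ℤ.- + 1) (sym last≡n)) (sub size lit)
    step : ∀ {σ j} → P (suc j) σ →
           σ ⊨ lit (+ 0) ≺ X × Halts σ (zero ≔ X ⊖ lit (+ 1) ⨾ body) (4 + T) (P j)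
    step {j = j} (x , at-x , x≡1+j , i) =
      lt lit reg (ℤ.+<+ (subst (0 <_) (sym x′≡) z<s)) ,
      seq-halts (move-halts y (as (trans (cong (λ k → + k ℤ.- + 1) x′≡) (cong +_ (sym y≡j))) (sub reg lit))
        λ σ₁ at-y same → weaken (run y at-y (subst₂ I (cong suc (sym y≡j)) (sym same) i))
          λ σ₂ (at-y′ , i₂) → y , at-y′ , y≡j , subst (λ k → I k _) y≡j i₂)
      where
      x′≡ = trans at-x x≡1+j
      j<n : j < n
      j<n = ℕ.<⇒≤ (subst (_< n) x≡1+j (Fin.toℕ<n x))
      y = fromℕ< j<n
      y≡j : toℕ y ≡ j
      y≡j = Fin.toℕ-fromℕ< j<n
    stop : ∀ {σ} → P 0 σ → σ ⊭ lit (+ 0) ≺ X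
    stop (x , at-x , x≡0 , _) =
      nlt lit reg λ { (ℤ.+<+ 0<r) → ℕ.<-irrefl (sym (trans at-x x≡0)) 0<r }
    bound : 4 + (T + suc (toℕ last) * (3 + (4 + T))) ≤ (11 + (T + T)) * n
    bound = begin
      4 + (T + suc (toℕ last) * (7 + T))  ≡⟨ cong (λ k → 4 + (T + k * (7 + T))) last≡n ⟩
      4 + (T + n * (7 + T))               ≡⟨ ℕ.+-assoc 4 T _ ⟨
      4 + T + n * (7 + T)                 ≤⟨ ℕ.+-monoˡ-≤ _ (ℕ.m≤n*m (4 + T) n) ⟩
      n * (4 + T) + n * (7 + T)           ≡⟨ ℕ.*-distribˡ-+ n (4 + T) (7 + T) ⟨
      n * (4 + T + (7 + T))               ≡⟨ ℕ.*-comm n _ ⟩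
      (4 + T + (7 + T)) * n               ≡⟨ cong (_* n) (collect T) ⟩
      (11 + (T + T)) * n                  ∎
      where
      open ℕ.≤-Reasoning
      collect : ∀ T → 4 + T + (7 + T) ≡ 11 + (T + T)
      collect T = cong (λ k → 4 + k) (trans (ℕ.+-comm T (7 + T)) (ℕ.+-assoc 7 T T))

------------------------------------------------------------------------
-- The algorithm

-- The current cell and the last cell.
cur end : Expr 1
cur = D[ here ]
end = D[ size ]

-- Step 1 for one element.
mark : Stmt 1
mark = IF cur ≗ here THEN D[ here ]≔ lit (+ 0) ELSE skip

-- Step 2 for one element.
tallyUp : Stmt 1
tallyUp = IF lit (+ 0) ≺ cur THEN D[ cur ]≔ D[ cur ] ⊖ lit (+ 1)
          ELSE (D[ here ]≔ cur ⊖ lit (+ 1))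

-- Step 3 for one element: at a root the size of its class is taken out of the
-- accumulator, and e is the value that the root receives.
advance : Expr 1 → Stmt 1
advance e = IF cur ≺ lit (+ 0) THEN (D[ size ]≔ end ⊖ cur ⨾ D[ here ]≔ e) ELSE skip

-- Puts the sentinel -n at the root of the last element, if the latter is idle.
announce : Stmt 1
announce = IF lit (+ 0) ≺ end THEN D[ end ]≔ lit (+ 0) ⊖ size ELSE skip

-- The scan from the left.
forward : Stmt 1
forward =
  zero ≔ lit (+ 0) ⨾
  announce ⨾
  D[ size ]≔ lit (+ 0) ⊖ size ⨾
  WHILE end ≺ cur DO (advance (lit (+ 0) ⊖ (size ⊕ end)) ⨾ zero ≔ here)

-- The scan from the right, starting next to the last element.
sweep : Stmt 1
sweep =
  zero ≔ size ⊖ lit (+ 2) ⨾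
  WHILE end ≺ cur DO (advance (cur ⊕ end) ⨾ zero ≔ X ⊖ lit (+ 1))

-- The rest of step 3, started at the sentinel.
backward : Stmt 1
backward =
  D[ size ]≔ lit (+ 0) ⊖ size ⨾
  IF here ≺ size
  THEN (sweep ⨾
        D[ here ]≔ end ⨾
        D[ size ]≔ here)
  ELSE skip

-- Step 4 for one element.  The pointer is needed to reach the root, so the root
-- is changed before the pointer is overwritten.
claim : Stmt 1
claim = IF lit (+ 0) ≺ cur
        THEN (D[ cur ]≔ D[ cur ] ⊕ lit (+ 1) ⨾ D[ here ]≔ lit (+ 1) ⊖ D[ cur ])
        ELSE skip

program : Stmt 1
program = downwards mark ⨾ downwards tallyUp ⨾ forward ⨾ backward ⨾ downwards claim

------------------------------------------------------------------------
-- Arithmetic of nonpositive integers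

neg : ℕ → ℤ
neg k = - (+ k)

neg-1 : ∀ k → neg k ℤ.- + 1 ≡ neg (suc k)
neg-1 k = trans (sym (ℤ.neg-distrib-+ (+ k) (+ 1))) (cong neg (ℕ.+-comm k 1))

neg-≤0 : ∀ k → neg k ℤ.≤ + 0
neg-≤0 k = ℤ.neg-mono-≤ (ℤ.+≤+ z≤n)

neg-< : ∀ {k l} → k < l → neg l ℤ.< neg k
neg-< k<l = ℤ.neg-mono-< (ℤ.+<+ k<l)

neg-<⁻ : ∀ {k l} → neg l ℤ.< neg k → k < l
neg-<⁻ neg< = ℤ.drop‿+<+ (ℤ.neg-cancel-< neg<)

neg-fits : ∀ {k n} → k ≤ n → ∣ neg k ∣ ≤ n
neg-fits {k} {n} k≤n = subst (_≤ n) (sym (ℤ.∣-i∣≡∣i∣ (+ k))) k≤n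

neg-minus : ∀ k l → neg (k + l) ℤ.- neg k ≡ neg l
neg-minus k l = trans (cong (λ z → - z ℤ.- neg k) (ℤ.pos-+ k l)) (cancel (+ k) (+ l))
  where
  cancel : ∀ a b → - (a ℤ.+ b) ℤ.- (- a) ≡ - b
  cancel = solve-∀

neg-plus : ∀ k l → neg k ℤ.+ neg l ≡ neg (l + k)
neg-plus k l = trans (sym (ℤ.neg-distrib-+ (+ k) (+ l))) (cong neg (ℕ.+-comm k l))

neg-rest : ∀ k l → + 0 ℤ.- (+ (k + l) ℤ.+ neg l) ≡ neg k
neg-rest k l = trans (cong (λ z → + 0 ℤ.- (z ℤ.+ neg l)) (ℤ.pos-+ k l)) (cancel (+ k) (+ l))
  where
  cancel : ∀ a b → + 0 ℤ.- ((a ℤ.+ b) ℤ.+ (- b)) ≡ - a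
  cancel = solve-∀

------------------------------------------------------------------------
-- Correctness and running time

-- A bound on the time of a program with at most n rounds of b units each and a
-- units outside the loop.
linear : ∀ a b {k n} → suc k ≤ n → a + suc k * b ≤ (a + b) * n
linear a b {k} {n} k<n = begin
  a + suc k * b    ≤⟨ ℕ.+-mono-≤ (ℕ.m≤m*n a n {{>-nonZero (ℕ.≤-<-trans z≤n k<n)}}) (ℕ.*-monoˡ-≤ b k<n) ⟩
  a * n + n * b    ≡⟨ cong (λ k → a * n + k) (ℕ.*-comm n b) ⟩
  a * n + b * n    ≡⟨ ℕ.*-distribʳ-+ n a b ⟨
  (a + b) * n      ∎
  where open ℕ.≤-Reasoning

-- The numbers in the time bounds are sums of unit costs in the program text, where
-- a conditional counts as its longer branch.
module Correctness {m : ℕ} (ι : IdempotentMap (suc m)) where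
  n = suc m
  open Ranking ι
  open Logic n

  -- The entry of y in the array that stores ι.
  pointer : Fin n → ℤ
  pointer y = + position (μ y)

  -- The idle elements hold entries as described by Idle, the roots by Rt.
  record Layout (Idle Rt : Fin n → ℤ → Set) (f : Fin n → ℤ) : Set where
    constructor layout
    field
      idle : ∀ {y} → ¬ Root y → Idle y (f y)
      root : ∀ {y} → Root y → Rt y (f y)
  open Layout

  -- The idle elements hold their pointers.
  Pointers : (Fin n → ℤ → Set) → (Fin n → ℤ) → Set
  Pointers = Layout (λ y z → z ≡ pointer y)

  idle≢root : ∀ {x y} → ¬ Root x → Root y → x ≢ y
  idle≢root idle root refl = idle root

  -- What holds at y when exactly the elements of index at least j have been
  -- processed: Before if y is not one of them, After if it is.
  Staged : ℕ → Fin n → Set → Set → Set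
  Staged j y Before After = (toℕ y < j → Before) × (j ≤ toℕ y → After)

  staged-shift : ∀ {x y A B} → y ≢ x → Staged (suc (toℕ x)) y A B → Staged (toℕ x) y A B
  staged-shift y≢x (before , after) =
    (λ y<x → before (ℕ.m<n⇒m<1+n y<x)) ,
    (λ x≤y → after (ℕ.≤∧≢⇒< x≤y λ e → y≢x (sym (Fin.toℕ-injective e))))

  staged-self : ∀ {x A B} → B → Staged (toℕ x) x A B
  staged-self b = (λ x<x → contradiction x<x (ℕ.<-irrefl refl)) , λ _ → b

  -- The roots during step 1.
  Marked : ℕ → Fin n → ℤ → Set
  Marked j y z = Staged j y (z ≡ pointer y) (z ≡ + 0)

  mark-halts : ∀ {σ} x → σ at x → Pointers (Marked (suc (toℕ x))) (contents σ) →
               Halts σ mark 13 (λ σ′ → σ′ at x × Pointers (Marked (toℕ x)) (contents σ′))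
  mark-halts {σ} x at-x inv with root? x
  ... | yes x-root =
    then-halts (eq (get-⇓ (here-⇓ at-x) (proj₁ (root inv x-root) ℕ.≤-refl)) (here-⇓ at-x)
                   (cong (λ y → + position y) x-root))
      (write-halts x x (+ 0) at-x (here-⇓ at-x) lit z≤n λ σ′ at-x′ new old → at-x′ , layout
        (λ {y} y-idle → trans (old y (idle≢root y-idle x-root)) (idle inv y-idle))
        (λ {y} y-root → marked y y-root new old))
    where
    marked : ∀ {g : Fin n → ℤ} y → Root y → g x ≡ + 0 → (∀ u → u ≢ x → g u ≡ contents σ u) →
             Marked (toℕ x) y (g y)
    marked y y-root new old with y Fin.≟ x
    ... | yes refl = staged-self new
    ... | no y≢x   = subst (Marked (toℕ x) y) (sym (old y y≢x)) (staged-shift y≢x (root inv y-root))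
  ... | no x-idle = within (ℕ.≤ᵇ⇒≤ 9 13 _)
    (else-halts (neq (get-⇓ (here-⇓ at-x) (idle inv x-idle)) (here-⇓ at-x)
                  λ e → x-idle (Fin.toℕ-injective (ℕ.suc-injective (ℤ.+-injective e))))
      (skip-halts (at-x , layout (idle inv) λ y-root →
        staged-shift (≢-sym (idle≢root x-idle y-root)) (root inv y-root))))

  -- The roots during step 2.
  Tallied : ℕ → Fin n → ℤ → Set
  Tallied j y z = z ≡ neg (tally j y)

  tallyUp-halts : ∀ {σ} x → σ at x → Pointers (Tallied (suc (toℕ x))) (contents σ) →
                  Halts σ tallyUp 18 (λ σ′ → σ′ at x × Pointers (Tallied (toℕ x)) (contents σ′))
  tallyUp-halts {σ} x at-x inv = result (root? x)
    where
    Post : State → Set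
    Post σ′ = σ′ at x × Pointers (Tallied (toℕ x)) (contents σ′)
    new-tally : neg (tally (suc (toℕ x)) (μ x)) ℤ.- + 1 ≡ neg (tally (toℕ x) (μ x))
    new-tally = trans (neg-1 _) (cong neg (sym (tally-hit x)))
    updated : ∀ σ′ → σ′ at x → contents σ′ (μ x) ≡ neg (tally (toℕ x) (μ x)) →
              (∀ u → u ≢ μ x → contents σ′ u ≡ contents σ u) → Post σ′
    updated σ′ at-x′ new old = at-x′ , layout
      (λ y-idle → trans (old _ (idle≢root y-idle (idempotent x))) (idle inv y-idle))
      tallied
      where
      tallied : ∀ {y} → Root y → Tallied (toℕ x) y (contents σ′ y)
      tallied {y} y-root with y Fin.≟ μ x
      ... | yes refl = new
      ... | no y≢μx  = trans (old y y≢μx) (trans (root inv y-root) (cong neg (sym (tally-miss x y≢μx))))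
    result : Dec (Root x) → Halts σ tallyUp 18 Post
    result (yes x-root) = within (ℕ.≤ᵇ⇒≤ 16 18 _)
      (else-≺ lit cur⇓ (ℤ.≤⇒≯ (neg-≤0 _))
        (write-halts x (μ x) _ at-x (as (cong (λ y → + position y) (sym x-root)) (here-⇓ at-x))
          (as (trans (cong (λ y → neg (tally (suc (toℕ x)) y) ℤ.- + 1) (sym x-root)) new-tally) (sub cur⇓ lit))
          (neg-fits (tally≤n _ _)) updated))
      where
      cur⇓ : σ ⊢ cur ⇓ neg (tally (suc (toℕ x)) x)
      cur⇓ = get-⇓ (here-⇓ at-x) (root inv x-root)
    result (no x-idle) =
      then-≺ lit cur⇓ (ℤ.+<+ z<s)
        (write-halts x (μ x) _ at-x cur⇓
          (as new-tally (sub (get-⇓ cur⇓ (root inv (idempotent x))) lit))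
          (neg-fits (tally≤n _ _)) updated)
      where
      cur⇓ : σ ⊢ cur ⇓ pointer x
      cur⇓ = get-⇓ (here-⇓ at-x) (idle inv x-idle)

  -- The idle elements during step 4.
  ClaimedIdle : ℕ → Fin n → ℤ → Set
  ClaimedIdle j y z = Staged j y (z ≡ pointer y) (z ≡ + suc (rank y))

  -- The array during step 4.  At a root, below y + idleBelow j y + 1 is the number
  -- that the next idle element of its class receives, or, when there is none left,
  -- the number of the root.
  Claimed : ℕ → (Fin n → ℤ) → Set
  Claimed j = Layout
    (ClaimedIdle j)
    (λ y z → z ≡ neg (suc (below (toℕ y) + idleBelow j y)))

  claim-halts : ∀ {σ} x → σ at x → Claimed (suc (toℕ x)) (contents σ) →
                Halts σ claim 29 (λ σ′ → σ′ at x × Claimed (toℕ x) (contents σ′))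
  claim-halts {σ} x at-x inv = result (root? x)
    where
    result : Dec (Root x) → Halts σ claim 29 (λ σ′ → σ′ at x × Claimed (toℕ x) (contents σ′))
    result (yes x-root) = within (ℕ.≤ᵇ⇒≤ 7 29 _)
      (else-≺ lit (get-⇓ (here-⇓ at-x) (root inv x-root)) (ℤ.≤⇒≯ (neg-≤0 _))
        (skip-halts (at-x , layout
          (λ y-idle → staged-shift (idle≢root y-idle x-root) (idle inv y-idle))
          (λ {y} y-root → trans (root inv y-root) (cong (λ i → neg (suc (below (toℕ y) + i)))
            (idleBelow-miss x λ x-idle → contradiction x-root x-idle))))))
    result (no x-idle) =
      then-≺ lit cur⇓ (ℤ.+<+ z<s)
        (seq-halts (write-halts x a (neg r) at-x cur⇓
            (as -suc-r+1 (add (get-⇓ cur⇓ (trans (root inv (idempotent x)) (cong neg (cong suc suc-r)))) lit))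
            (neg-fits (subst (_≤ n) (rank-idle x-idle) (ℕ.<⇒≤ (rank<n x))))
          λ σ₁ at₁ new₁ old₁ →
            let cur₁⇓ = get-⇓ (here-⇓ at₁) (trans (old₁ x x≢a) x-todo) in
          write-halts x x (+ suc (rank x)) at₁ (here-⇓ at₁)
            (as 1+r (sub lit (get-⇓ cur₁⇓ new₁))) (rank<n x)
          λ σ₂ at₂ new₂ old₂ → at₂ , layout
            (λ y-idle → claimed y-idle (old₁ _ (idle≢root y-idle (idempotent x))) (old₂ _) new₂)
            (λ y-root → rooted y-root (trans (old₂ a (≢-sym x≢a)) new₁) λ y≢a →
              trans (old₂ _ (≢-sym (idle≢root x-idle y-root))) (old₁ _ y≢a))))
      where
      a = μ x
      r = suc (below (toℕ a) + idleBelow (toℕ x) a)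
      x≢a : x ≢ a
      x≢a = idle≢root x-idle (idempotent x)
      x-todo : contents σ x ≡ pointer x
      x-todo = proj₁ (idle inv x-idle) ℕ.≤-refl
      cur⇓ : σ ⊢ cur ⇓ pointer x
      cur⇓ = get-⇓ (here-⇓ at-x) x-todo
      suc-r : below (toℕ a) + idleBelow (suc (toℕ x)) a ≡ r
      suc-r = trans (cong (λ i → below (toℕ a) + i) (idleBelow-hit x-idle)) (ℕ.+-suc _ _)
      -suc-r+1 : neg (suc r) ℤ.+ + 1 ≡ neg r
      -suc-r+1 = refl
      1+r : + 1 ℤ.- neg r ≡ + suc (rank x)
      1+r = cong (λ k → + suc k) (sym (rank-idle x-idle))
      claimed : ∀ {y z} {g : Fin n → ℤ} → ¬ Root y → z ≡ contents σ y → (y ≢ x → g y ≡ z) →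
                g x ≡ + suc (rank x) → ClaimedIdle (toℕ x) y (g y)
      claimed {y} y-idle z≡ old new with y Fin.≟ x
      ... | yes refl = staged-self new
      ... | no y≢x   = subst (ClaimedIdle (toℕ x) y) (sym (trans (old y≢x) z≡))
                         (staged-shift y≢x (idle inv y-idle))
      rooted : ∀ {y} {g : Fin n → ℤ} → Root y → g a ≡ neg r → (y ≢ a → g y ≡ contents σ y) →
        g y ≡ neg (suc (below (toℕ y) + idleBelow (toℕ x) y))
      rooted {y} y-root new old with y Fin.≟ a
      ... | yes refl = new
      ... | no y≢a   = trans (old y≢a) (trans (root inv y-root)
                         (cong (λ i → neg (suc (below (toℕ y) + i))) (idleBelow-miss x λ _ → y≢a)))

  -- The last element and its root.
  last ℓ : Fin n
  last = fromℕ m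
  ℓ    = μ last

  last≡n : position last ≡ n
  last≡n = cong suc (Fin.toℕ-fromℕ m)

  ≤last : ∀ y → toℕ y ≤ toℕ last
  ≤last y = s≤s⁻¹ (subst (position y ≤_) (sym last≡n) (Fin.toℕ<n y))

  <last : ∀ {y} → y ≢ last → toℕ y < toℕ last
  <last {y} y≢last = ℕ.≤∧≢⇒< (≤last y) (y≢last ∘ Fin.toℕ-injective)

  -- The array during step 3: roots satisfying Done have received their sums.  The
  -- cell of ℓ holds the sentinel, unless it is the last cell, which holds the
  -- accumulator.
  record Scan (Done : Fin n → Set) (acc : ℕ) (f : Fin n → ℤ) : Set where
    field
      at-last  : f last ≡ neg acc
      at-ℓ     : ℓ ≢ last → f ℓ ≡ neg n
      idle     : ∀ {y} → ¬ Root y → y ≢ last → f y ≡ pointer y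
      done     : ∀ {y} → Root y → y ≢ last → y ≢ ℓ → Done y → f y ≡ neg (below (suc (toℕ y)))
      pending  : ∀ {y} → Root y → y ≢ last → y ≢ ℓ → ¬ Done y → f y ≡ neg (fibre y)

  open Scan

  scan-continue : ∀ {Done acc σ x} → Scan Done acc (contents σ) → σ at x → x ≢ last → x ≢ ℓ →
                  ¬ Done x → fibre x < acc → σ ⊨ end ≺ cur
  scan-continue {Done} {acc} {σ} {x} scan at-x x≢last x≢ℓ todo fibre<acc = result (root? x)
    where
    result : Dec (Root x) → σ ⊨ end ≺ cur
    result (yes x-root) =
      lt (get-⇓ (size-⇓ {y = last} last≡n) (at-last scan))
         (get-⇓ (here-⇓ at-x) (pending scan x-root x≢last x≢ℓ todo)) (neg-< fibre<acc)
    result (no x-idle) =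
      lt (get-⇓ (size-⇓ {y = last} last≡n) (at-last scan))
         (get-⇓ (here-⇓ at-x) (idle scan x-idle x≢last)) (ℤ.≤-<-trans (neg-≤0 acc) (ℤ.+<+ z<s))

  scan-stop : ∀ {Done acc σ} → Scan Done acc (contents σ) → σ at ℓ → acc ≤ n → σ ⊭ end ≺ cur
  scan-stop {Done} {acc} {σ} scan at-ℓ′ acc≤n = result (ℓ Fin.≟ last)
    where
    result : Dec (ℓ ≡ last) → σ ⊭ end ≺ cur
    result (yes ℓ≡last) =
      nlt (get-⇓ (size-⇓ {y = last} last≡n) (at-last scan))
          (get-⇓ (here-⇓ at-ℓ′) (trans (cong (contents σ) ℓ≡last) (at-last scan))) (ℤ.<-irrefl refl)
    result (no ℓ≢last) =
      nlt (get-⇓ (size-⇓ {y = last} last≡n) (at-last scan))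
          (get-⇓ (here-⇓ at-ℓ′) (at-ℓ scan ℓ≢last)) (λ lt → ℕ.<⇒≱ (neg-<⁻ lt) acc≤n)

  -- One round of a scan, which makes x done.  The value of e is required only in the
  -- state in which the accumulator has been updated.
  advance-halts : ∀ {Done Done′ acc acc′ e σ x} → Scan Done acc (contents σ) → σ at x →
    x ≢ last → x ≢ ℓ → ¬ Done x → acc ≡ fibre x + acc′ → acc ≤ n →
    (∀ {y} → y ≢ x → Done′ y → Done y) → (∀ {y} → Done y → Done′ y) → Done′ x →
    (∀ σ′ → σ′ at x → contents σ′ last ≡ neg acc′ → contents σ′ x ≡ neg (fibre x) →
      σ′ ⊢ e ⇓ neg (below (suc (toℕ x)))) →
    Halts σ (advance e) (19 + cost e) (λ σ′ → σ′ at x × Scan Done′ acc′ (contents σ′))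
  advance-halts {Done} {Done′} {acc} {acc′} {e} {σ} {x}
                scan at-x x≢last x≢ℓ todo acc≡ acc≤n Done′⊆ ⊆Done′ done-x e⇓ = result (root? x)
    where
    Post : State → Set
    Post σ′ = σ′ at x × Scan Done′ acc′ (contents σ′)
    result : Dec (Root x) → Halts σ (advance e) (19 + cost e) Post
    result (no x-idle) = within (ℕ.m≤m+n 7 _)
      (else-≺ (get-⇓ (here-⇓ at-x) (idle scan x-idle x≢last)) lit (λ { (ℤ.+<+ ()) })
        (skip-halts (at-x , record
          { at-last = trans (at-last scan) (cong neg (trans acc≡ (cong (_+ acc′) (fibre-idle x-idle))))
          ; at-ℓ    = at-ℓ scan
          ; idle    = idle scan
          ; done    = λ y-root y≢last y≢ℓ done-y → done scan y-root y≢last y≢ℓ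
                        (Done′⊆ (≢-sym (idle≢root x-idle y-root)) done-y)
          ; pending = λ y-root y≢last y≢ℓ todo-y → pending scan y-root y≢last y≢ℓ (todo-y ∘ ⊆Done′)
          })))
    result (yes x-root) =
      then-≺ cur⇓ lit (neg-< (fibre-pos x-root))
        (seq-halts (write-halts x last (neg acc′) at-x (size-⇓ {y = last} last≡n)
            (as (trans (cong (λ k → neg k ℤ.- neg (fibre x)) acc≡) (neg-minus (fibre x) acc′))
                (sub (get-⇓ (size-⇓ {y = last} last≡n) (at-last scan)) cur⇓))
            (neg-fits (ℕ.≤-trans (ℕ.≤-trans (ℕ.m≤n+m acc′ (fibre x)) (ℕ.≤-reflexive (sym acc≡))) acc≤n))
          λ σ₁ at₁ new₁ old₁ →
          write-halts x x _ at₁ (here-⇓ at₁) (e⇓ σ₁ at₁ new₁ (trans (old₁ x x≢last) x-pending))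
            (neg-fits (below≤n _))
          λ σ₂ at₂ new₂ old₂ →
          let old : ∀ {y} → y ≢ x → y ≢ last → contents σ₂ y ≡ contents σ y
              old y≢x y≢last = trans (old₂ _ y≢x) (old₁ _ y≢last) in
          at₂ , record
          { at-last = trans (old₂ last (≢-sym x≢last)) new₁
          ; at-ℓ    = λ ℓ≢last → trans (old (≢-sym x≢ℓ) ℓ≢last) (at-ℓ scan ℓ≢last)
          ; idle    = λ y-idle y≢last → trans (old (idle≢root y-idle x-root) y≢last) (idle scan y-idle y≢last)
          ; done    = λ {y} → done′ σ₂ new₂ old y
          ; pending = λ y-root y≢last y≢ℓ todo-y →
              trans (old (λ { refl → todo-y done-x }) y≢last)
                    (pending scan y-root y≢last y≢ℓ (todo-y ∘ ⊆Done′))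
          }))
      where
      x-pending : contents σ x ≡ neg (fibre x)
      x-pending = pending scan x-root x≢last x≢ℓ todo
      cur⇓ : σ ⊢ cur ⇓ neg (fibre x)
      cur⇓ = get-⇓ (here-⇓ at-x) x-pending
      done′ : ∀ σ₂ → contents σ₂ x ≡ neg (below (suc (toℕ x))) →
              (∀ {y} → y ≢ x → y ≢ last → contents σ₂ y ≡ contents σ y) →
              ∀ y → Root y → y ≢ last → y ≢ ℓ → Done′ y → contents σ₂ y ≡ neg (below (suc (toℕ y)))
      done′ σ₂ new old y y-root y≢last y≢ℓ done-y with y Fin.≟ x
      ... | yes refl = new
      ... | no y≢x   = trans (old y≢x y≢last) (done scan y-root y≢last y≢ℓ (Done′⊆ y≢x done-y))

  -- The roots that are done when the scan from the left, respectively from the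
  -- right, is at index j.
  Before : ℕ → Fin n → Set
  Before j y = toℕ y < j

  Outside : ℕ → Fin n → Set
  Outside j y = toℕ y < toℕ ℓ ⊎ j < toℕ y

  -- The roots before and after step 3.
  Fibres Sums : Fin n → ℤ → Set
  Fibres y z = z ≡ neg (fibre y)
  Sums   y z = z ≡ neg (below (suc (toℕ y)))

  0-n : ∀ {σ} → σ ⊢ lit (+ 0) ⊖ size ⇓ neg n
  0-n = as refl (sub lit size)

  -- The array in step 3 before the accumulator is set up; the entry of a last element
  -- that is a root is no longer needed.
  record Announced (f : Fin n → ℤ) : Set where
    constructor announced
    field
      pointers : ∀ {y} → ¬ Root y → f y ≡ pointer y
      fibres   : ∀ {y} → Root y → y ≢ last → y ≢ ℓ → f y ≡ neg (fibre y)
      mark-ℓ   : ℓ ≢ last → f ℓ ≡ neg n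

  announce-halts : ∀ {σ x} → σ at x → Pointers Fibres (contents σ) →
    Halts σ announce 10 (λ σ′ → σ′ at x × Announced (contents σ′))
  announce-halts {σ} {x} at-x inv = result (root? last)
    where
    result : Dec (Root last) → Halts σ announce 10 (λ σ′ → σ′ at x × Announced (contents σ′))
    result (yes last-root) = within (ℕ.≤ᵇ⇒≤ 5 10 _)
      (else-≺ lit (get-⇓ (size-⇓ {y = last} last≡n) (root inv last-root)) (ℤ.≤⇒≯ (neg-≤0 _))
        (skip-halts (at-x , announced (idle inv) (λ y-root _ _ → root inv y-root)
                     λ ℓ≢last → contradiction last-root ℓ≢last)))
    result (no last-idle) =
      then-≺ lit end⇓ (ℤ.+<+ z<s)
        (write-halts x ℓ (neg n) at-x end⇓ 0-n (neg-fits {n} ℕ.≤-refl) λ σ₁ at₁ new old →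
          at₁ , announced
            (λ y-idle → trans (old _ (idle≢root y-idle (idempotent last))) (idle inv y-idle))
            (λ y-root _ y≢ℓ → trans (old _ y≢ℓ) (root inv y-root))
            λ _ → new)
      where
      end⇓ : σ ⊢ end ⇓ pointer last
      end⇓ = get-⇓ (size-⇓ {y = last} last≡n) (idle inv last-idle)

  forward-halts : ∀ {σ} → Pointers Fibres (contents σ) →
    Halts σ forward (53 * n) (λ σ′ → σ′ at ℓ × Scan (Before (toℕ ℓ)) (above (toℕ ℓ)) (contents σ′))
  forward-halts {σ} inv = within bound
    (seq-halts (move-halts zero lit λ σ₀ at₀ same →
     seq-halts (weaken (announce-halts at₀ (subst (Pointers Fibres) (sym same) inv)) λ σ₁ (at₁ , ann) →
     seq-halts (write-halts zero last (neg n) at₁ (size-⇓ {y = last} last≡n) 0-n (neg-fits {n} ℕ.≤-refl)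
     λ σ₂ at₂ new old → weaken
       (while-halts P step stop (toℕ ℓ) (zero , at₂ , refl , start ann new old))
       λ { σ₃ (x , at₃ , x≡ℓ , scan) →
            finish σ₃ at₃ (Fin.toℕ-injective (trans (sym (ℕ.+-identityʳ _)) x≡ℓ)) scan }))))
    where
    P : ℕ → State → Set
    P k σ = ∃[ x ] σ at x × toℕ x + k ≡ toℕ ℓ × Scan (Before (toℕ x)) (above (toℕ x)) (contents σ)

    finish : ∀ σ {x} → σ at x → x ≡ ℓ → Scan (Before (toℕ x)) (above (toℕ x)) (contents σ) →
             σ at ℓ × Scan (Before (toℕ ℓ)) (above (toℕ ℓ)) (contents σ)
    finish σ at-x refl scan = at-x , scan

    start : ∀ {f g : Fin n → ℤ} → Announced f → g last ≡ neg n → (∀ u → u ≢ last → g u ≡ f u) →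
            Scan (Before 0) (above 0) g
    start (announced ptr fib ann) new old = record
      { at-last = trans new (cong neg (sym above-bottom))
      ; at-ℓ    = λ ℓ≢last → trans (old ℓ ℓ≢last) (ann ℓ≢last)
      ; idle    = λ y-idle y≢last → trans (old _ y≢last) (ptr y-idle)
      ; done    = λ _ _ _ ()
      ; pending = λ y-root y≢last y≢ℓ _ → trans (old _ y≢last) (fib y-root y≢last y≢ℓ)
      }

    step : ∀ {σ k} → P (suc k) σ →
           σ ⊨ end ≺ cur × Halts σ (advance (lit (+ 0) ⊖ (size ⊕ end)) ⨾ zero ≔ here) 29 (P k)
    step {σ} {k} (x , at-x , x+1+k≡ℓ , scan) =
      scan-continue scan at-x x≢last x≢ℓ (ℕ.<-irrefl refl) fibre<above ,
      seq-halts (weaken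
        (advance-halts {Done′ = Before (suc (toℕ x))} {acc′ = above (suc (toℕ x))}
          scan at-x x≢last x≢ℓ (ℕ.<-irrefl refl) (above-suc x) (above≤n (toℕ x))
          (λ y≢x y≤x → ℕ.≤∧≢⇒< (s≤s⁻¹ y≤x) (y≢x ∘ Fin.toℕ-injective)) ℕ.m<n⇒m<1+n ℕ.≤-refl sum⇓)
        λ σ₁ (at₁ , scan₁) → move-halts y (as (cong +_ (sym y≡1+x)) (here-⇓ at₁))
        λ σ₂ at₂ same → y , at₂ , trans (cong (_+ k) y≡1+x) (trans (sym (ℕ.+-suc (toℕ x) k)) x+1+k≡ℓ) ,
          subst₂ (λ j → Scan (Before j) (above j)) (sym y≡1+x) (sym same) scan₁)
      where
      x<ℓ : toℕ x < toℕ ℓ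
      x<ℓ = subst (toℕ x <_) x+1+k≡ℓ (ℕ.m<m+n (toℕ x) z<s)
      x≢ℓ : x ≢ ℓ
      x≢ℓ refl = ℕ.<-irrefl refl x<ℓ
      x≢last : x ≢ last
      x≢last refl = ℕ.<⇒≱ x<ℓ (≤last ℓ)
      -- The last element belongs to the class of ℓ, which is still to come.
      fibre<above : fibre x < above (toℕ x)
      fibre<above = subst (fibre x <_) (sym (above-suc x)) (ℕ.m<m+n (fibre x) (above-pos last x<ℓ))
      y<n : suc (toℕ x) < n
      y<n = ℕ.≤-<-trans x<ℓ (Fin.toℕ<n ℓ)
      y : Fin n
      y = fromℕ< y<n
      y≡1+x : toℕ y ≡ suc (toℕ x)
      y≡1+x = Fin.toℕ-fromℕ< y<n
      sum⇓ : ∀ σ′ → σ′ at x → contents σ′ last ≡ neg (above (suc (toℕ x))) → contents σ′ x ≡ neg (fibre x) →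
             σ′ ⊢ lit (+ 0) ⊖ (size ⊕ end) ⇓ neg (below (suc (toℕ x)))
      sum⇓ σ′ at′ at-last′ _ = as
        (trans (cong (λ k → + 0 ℤ.- (+ k ℤ.+ neg (above (suc (toℕ x))))) (sym (below+above (suc (toℕ x)))))
               (neg-rest (below (suc (toℕ x))) (above (suc (toℕ x)))))
        (sub lit (add size (get-⇓ (size-⇓ {y = last} last≡n) at-last′)))

    stop : ∀ {σ} → P 0 σ → σ ⊭ end ≺ cur
    stop {σ} (x , at-x , x+0≡ℓ , scan) =
      let at-ℓ′ , scan′ = finish σ at-x (Fin.toℕ-injective (trans (sym (ℕ.+-identityʳ _)) x+0≡ℓ)) scan in
      scan-stop scan′ at-ℓ′ (above≤n (toℕ ℓ))

    bound : 17 + suc (toℕ ℓ) * 36 ≤ 53 * n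
    bound = linear 17 36 {toℕ ℓ} {n} (Fin.toℕ<n ℓ)

  -- A scan may be restarted with another accumulator, and Done matters only off the
  -- last cell.
  scan-retarget : ∀ {Done Done′ acc acc′ f g} → Scan Done acc f → g last ≡ neg acc′ →
                  (∀ y → y ≢ last → g y ≡ f y) →
                  (∀ {y} → y ≢ last → Done y → Done′ y) → (∀ {y} → y ≢ last → Done′ y → Done y) →
                  Scan Done′ acc′ g
  scan-retarget scan new old ⊆Done′ Done′⊆ = record
    { at-last = new
    ; at-ℓ    = λ ℓ≢last → trans (old _ ℓ≢last) (at-ℓ scan ℓ≢last)
    ; idle    = λ y-idle y≢last → trans (old _ y≢last) (idle scan y-idle y≢last)
    ; done    = λ y-root y≢last y≢ℓ d → trans (old _ y≢last) (done scan y-root y≢last y≢ℓ (Done′⊆ y≢last d))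
    ; pending = λ y-root y≢last y≢ℓ p →
        trans (old _ y≢last) (pending scan y-root y≢last y≢ℓ (p ∘ ⊆Done′ y≢last))
    }

  -- The last element is idle here, so that ℓ comes before it.
  sweep-halts : ∀ {σ} → ℓ ≢ last → σ at ℓ → Scan (Before (toℕ ℓ)) n (contents σ) →
    Halts σ sweep (4 + suc (toℕ last) * 37)
      (λ σ′ → σ′ at ℓ × Scan (Outside (toℕ ℓ)) (below (suc (toℕ ℓ))) (contents σ′))
  sweep-halts {σ} ℓ≢last at-ℓ₀ scan = within (ℕ.+-monoʳ-≤ 4 (ℕ.*-monoˡ-≤ 37 (s≤s k₀≤last)))
    (seq-halts (move-halts x₀ (as 1+m-2 (sub size lit)) λ σ₁ at₁ same → weaken
      (while-halts P step stop k₀ (x₀ , at₁ , ℓ+k₀ , x₀<last , subst (Scan _ _) (sym same) start))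
      λ { σ₂ (x , at₂ , x≡ℓ , _ , scan₂) →
            finish σ₂ at₂ (Fin.toℕ-injective (trans (sym x≡ℓ) (ℕ.+-identityʳ _))) scan₂ }))
    where
    P : ℕ → State → Set
    P k σ = ∃[ x ] σ at x × toℕ ℓ + k ≡ toℕ x × toℕ x < toℕ last ×
            Scan (Outside (toℕ x)) (below (suc (toℕ x))) (contents σ)

    finish : ∀ σ {x} → σ at x → x ≡ ℓ → Scan (Outside (toℕ x)) (below (suc (toℕ x))) (contents σ) →
             σ at ℓ × Scan (Outside (toℕ ℓ)) (below (suc (toℕ ℓ))) (contents σ)
    finish σ at-x refl scan = at-x , scan

    ℓ<m : toℕ ℓ < m
    ℓ<m = subst (toℕ ℓ <_) (Fin.toℕ-fromℕ m) (<last ℓ≢last)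
    m≡ : suc (pred m) ≡ m
    m≡ = ℕ.suc-pred m {{>-nonZero (ℕ.≤-<-trans z≤n ℓ<m)}}
    x₀<n : pred m < n
    x₀<n = s≤s (ℕ.pred[n]≤n {m})
    x₀ : Fin n
    x₀ = fromℕ< x₀<n
    x₀≡ : toℕ x₀ ≡ pred m
    x₀≡ = Fin.toℕ-fromℕ< x₀<n
    1+x₀≡last : suc (toℕ x₀) ≡ toℕ last
    1+x₀≡last = trans (cong suc x₀≡) (trans m≡ (sym (Fin.toℕ-fromℕ m)))
    x₀<last : toℕ x₀ < toℕ last
    x₀<last = ℕ.≤-reflexive 1+x₀≡last
    1+m-2 : + n ℤ.- + 2 ≡ + toℕ x₀
    1+m-2 = trans (cong (λ k → + suc k ℤ.- + 2) (sym m≡)) (cong +_ (sym x₀≡))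
    k₀ : ℕ
    k₀ = toℕ x₀ ∸ toℕ ℓ
    ℓ+k₀ : toℕ ℓ + k₀ ≡ toℕ x₀
    ℓ+k₀ = ℕ.m+[n∸m]≡n (s≤s⁻¹ (subst (toℕ ℓ <_) (sym 1+x₀≡last) (<last ℓ≢last)))
    k₀≤last : k₀ ≤ toℕ last
    k₀≤last = ℕ.≤-trans (ℕ.m∸n≤m (toℕ x₀) (toℕ ℓ)) (ℕ.<⇒≤ x₀<last)

    -- The class of an idle element is empty, so all elements are accounted for.
    n≡below : n ≡ below (suc (toℕ x₀))
    n≡below = begin
      n                                ≡⟨ below-top (ℕ.≤-reflexive (sym last≡n)) ⟨
      below (suc (toℕ last))           ≡⟨ below-suc last ⟩
      below (toℕ last) + fibre last    ≡⟨ cong (λ k → below (toℕ last) + k) (fibre-idle ℓ≢last) ⟩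
      below (toℕ last) + 0             ≡⟨ ℕ.+-identityʳ _ ⟩
      below (toℕ last)                 ≡⟨ cong below 1+x₀≡last ⟨
      below (suc (toℕ x₀))             ∎
      where open ≡-Reasoning

    start : Scan (Outside (toℕ x₀)) (below (suc (toℕ x₀))) (contents σ)
    start = scan-retarget scan (trans (at-last scan) (cong neg n≡below)) (λ _ _ → refl)
      (λ _ → inj₁)
      λ { y≢last (inj₁ y<ℓ)  → y<ℓ
        ; y≢last (inj₂ x₀<y) → contradiction
            (ℕ.≤-<-trans (ℕ.≤-trans (ℕ.≤-reflexive (sym 1+x₀≡last)) x₀<y) (<last y≢last)) (ℕ.<-irrefl refl) }

    step : ∀ {σ k} → P (suc k) σ →
           σ ⊨ end ≺ cur × Halts σ (advance (cur ⊕ end) ⨾ zero ≔ X ⊖ lit (+ 1)) 30 (P k)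
    step {σ} {k} (x , at-x , ℓ+1+k≡x , x<last , scan) =
      scan-continue scan at-x x≢last x≢ℓ todo fibre<below ,
      seq-halts (weaken
        (advance-halts {Done′ = Outside (toℕ y)} {acc′ = below (toℕ x)}
          scan at-x x≢last x≢ℓ todo (trans (below-suc x) (ℕ.+-comm _ (fibre x))) (below≤n _)
          (λ { _   (inj₁ z<ℓ) → inj₁ z<ℓ
             ; z≢x (inj₂ y<z) → inj₂ (ℕ.≤∧≢⇒< (subst (_≤ _) 1+y≡x y<z) λ e → z≢x (sym (Fin.toℕ-injective e))) })
          [ inj₁ , (λ x<z → inj₂ (ℕ.<-trans y<x x<z)) ]′ (inj₂ y<x) sum⇓)
        λ σ₁ (at₁ , scan₁) → move-halts y
          (as (cong (λ k → + k ℤ.- + 1) (trans at₁ (sym 1+y≡x))) (sub reg lit))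
        λ σ₂ at₂ same → y , at₂ , sym y≡ℓ+k , ℕ.<-trans y<x x<last ,
          subst₂ (λ j → Scan (Outside (toℕ y)) (below j)) (sym 1+y≡x) (sym same) scan₁)
      where
      y<n : toℕ ℓ + k < n
      y<n = ℕ.<-trans (subst (toℕ ℓ + k <_) ℓ+1+k≡x (ℕ.+-monoʳ-< (toℕ ℓ) (ℕ.n<1+n k))) (Fin.toℕ<n x)
      y : Fin n
      y = fromℕ< y<n
      y≡ℓ+k : toℕ y ≡ toℕ ℓ + k
      y≡ℓ+k = Fin.toℕ-fromℕ< y<n
      1+y≡x : suc (toℕ y) ≡ toℕ x
      1+y≡x = trans (cong suc y≡ℓ+k) (trans (sym (ℕ.+-suc (toℕ ℓ) k)) ℓ+1+k≡x)
      y<x : toℕ y < toℕ x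
      y<x = ℕ.≤-reflexive 1+y≡x
      ℓ<x : toℕ ℓ < toℕ x
      ℓ<x = subst (toℕ ℓ <_) ℓ+1+k≡x (ℕ.m<m+n (toℕ ℓ) z<s)
      x≢ℓ : x ≢ ℓ
      x≢ℓ refl = ℕ.<-irrefl refl ℓ<x
      x≢last : x ≢ last
      x≢last refl = ℕ.<-irrefl refl x<last
      todo : ¬ Outside (toℕ x) x
      todo = [ ℕ.<-asym ℓ<x , ℕ.<-irrefl refl ]′
      -- The last element belongs to the class of ℓ, which is still to come.
      fibre<below : fibre x < below (suc (toℕ x))
      fibre<below = subst (fibre x <_) (sym (below-suc x)) (ℕ.m<n+m (fibre x) (below-pos last ℓ<x))
      sum⇓ : ∀ σ′ → σ′ at x → contents σ′ last ≡ neg (below (toℕ x)) → contents σ′ x ≡ neg (fibre x) →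
             σ′ ⊢ cur ⊕ end ⇓ neg (below (suc (toℕ x)))
      sum⇓ σ′ at′ at-last′ x-pending = as
        (trans (neg-plus (fibre x) (below (toℕ x))) (cong neg (sym (below-suc x))))
        (add (get-⇓ (here-⇓ at′) x-pending) (get-⇓ (size-⇓ {y = last} last≡n) at-last′))

    stop : ∀ {σ} → P 0 σ → σ ⊭ end ≺ cur
    stop {σ} (x , at-x , ℓ+0≡x , _ , scan) =
      let at-ℓ′ , scan′ = finish σ at-x (Fin.toℕ-injective (trans (sym ℓ+0≡x) (ℕ.+-identityʳ _))) scan in
      scan-stop scan′ at-ℓ′ (below≤n _)

  backward-halts : ∀ {σ acc} → σ at ℓ → Scan (Before (toℕ ℓ)) acc (contents σ) →
    Halts σ backward (62 * n) (Pointers Sums ∘ contents)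
  backward-halts {σ} at-ℓ₀ scan = within (linear 25 37 {toℕ last} {n} (Fin.toℕ<n last))
    (seq-halts (write-halts ℓ last (neg n) at-ℓ₀ (size-⇓ {y = last} last≡n) 0-n (neg-fits {n} ℕ.≤-refl)
     λ σ₁ at₁ new old →
       result (ℓ Fin.≟ last) at₁ (scan-retarget scan new old (λ _ d → d) (λ _ d → d))))
    where
    result : Dec (ℓ ≡ last) → ∀ {σ} → σ at ℓ → Scan (Before (toℕ ℓ)) n (contents σ) →
             Halts σ (IF here ≺ size THEN (sweep ⨾ D[ here ]≔ end ⨾ D[ size ]≔ here) ELSE skip)
                   (20 + suc (toℕ last) * 37) (Pointers Sums ∘ contents)
    result (yes ℓ≡last) {σ} at₁ scan₁ = within (ℕ.m≤m+n 6 _)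
      (else-≺ (here-⇓ at₁) size (λ { (ℤ.+<+ ℓ<n) → ℕ.<-irrefl (trans (cong position ℓ≡last) last≡n) ℓ<n })
        (skip-halts (layout
          (λ y-idle → idle scan₁ y-idle (≢-sym (idle≢root y-idle ℓ≡last ∘ sym)))
          (λ {y} → sums y))))
      where
      sums : ∀ y → Root y → contents σ y ≡ neg (below (suc (toℕ y)))
      sums y y-root with y Fin.≟ last
      ... | yes refl   = trans (at-last scan₁) (cong neg (sym (below-top (ℕ.≤-reflexive (sym last≡n)))))
      ... | no  y≢last = done scan₁ y-root y≢last (λ y≡ℓ → y≢last (trans y≡ℓ ℓ≡last))
                           (subst (toℕ y <_) (sym (cong toℕ ℓ≡last)) (<last y≢last))
    result (no ℓ≢last) {σ} at₁ scan₁ = within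
      (ℕ.≤-reflexive (cong (λ k → 9 + k) (ℕ.+-comm (suc (toℕ last) * 37) 11)))
      (then-≺ (here-⇓ at₁) size (ℤ.+<+ (subst (position ℓ <_) last≡n (s≤s (<last ℓ≢last))))
        (seq-halts (weaken (sweep-halts ℓ≢last at₁ scan₁) λ σ₂ (at₂ , scan₂) →
         seq-halts (write-halts ℓ ℓ _ at₂ (here-⇓ at₂)
           (get-⇓ (size-⇓ {y = last} last≡n) (at-last scan₂)) (neg-fits (below≤n _))
         λ σ₃ at₃ new₃ old₃ →
         write-halts ℓ last _ at₃ (size-⇓ {y = last} last≡n) (here-⇓ at₃) (Fin.toℕ<n ℓ)
         λ σ₄ at₄ new₄ old₄ → layout
           (λ {y} → ptrs σ₂ σ₃ σ₄ scan₂ new₄ old₃ old₄ y)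
           (λ {y} → sums σ₂ σ₃ σ₄ scan₂ new₃ old₃ old₄ y)))))
      where
      ptrs : ∀ σ₂ σ₃ σ₄ → Scan (Outside (toℕ ℓ)) (below (suc (toℕ ℓ))) (contents σ₂) →
             contents σ₄ last ≡ pointer last → (∀ y → y ≢ ℓ → contents σ₃ y ≡ contents σ₂ y) →
             (∀ y → y ≢ last → contents σ₄ y ≡ contents σ₃ y) →
             ∀ y → ¬ Root y → contents σ₄ y ≡ pointer y
      ptrs σ₂ σ₃ σ₄ scan₂ new₄ old₃ old₄ y y-idle with y Fin.≟ last
      ... | yes refl   = new₄
      ... | no  y≢last = trans (old₄ y y≢last) (trans (old₃ y (idle≢root y-idle (idempotent last)))
                           (idle scan₂ y-idle y≢last))
      sums : ∀ σ₂ σ₃ σ₄ → Scan (Outside (toℕ ℓ)) (below (suc (toℕ ℓ))) (contents σ₂) →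
             contents σ₃ ℓ ≡ neg (below (suc (toℕ ℓ))) → (∀ y → y ≢ ℓ → contents σ₃ y ≡ contents σ₂ y) →
             (∀ y → y ≢ last → contents σ₄ y ≡ contents σ₃ y) →
             ∀ y → Root y → contents σ₄ y ≡ neg (below (suc (toℕ y)))
      sums σ₂ σ₃ σ₄ scan₂ new₃ old₃ old₄ y y-root with y Fin.≟ ℓ
      ... | yes refl = trans (old₄ y ℓ≢last) new₃
      ... | no  y≢ℓ  = trans (old₄ y y≢last) (trans (old₃ y y≢ℓ)
            (done scan₂ y-root y≢last y≢ℓ (outside (ℕ.<-cmp (toℕ y) (toℕ ℓ)))))
        where
        y≢last : y ≢ last
        y≢last = ≢-sym (idle≢root ℓ≢last y-root)
        outside : Tri (toℕ y < toℕ ℓ) (toℕ y ≡ toℕ ℓ) (toℕ ℓ < toℕ y) → Outside (toℕ ℓ) y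
        outside (tri< y<ℓ _ _) = inj₁ y<ℓ
        outside (tri≈ _ y≡ℓ _) = contradiction (Fin.toℕ-injective y≡ℓ) y≢ℓ
        outside (tri> _ _ ℓ<y) = inj₂ ℓ<y

  program-halts : ∀ {σ} → (∀ y → contents σ y ≡ pointer y) →
    Halts σ program (37 * n + (47 * n + (53 * n + (62 * n + 69 * n))))
      (λ σ′ → ∀ x → contents σ′ x ≡ IdempotentPermutation.signed (Corresponding.permutationOf ι) x)
  program-halts init =
    seq-halts (weaken (downwards-halts (Pointers ∘ Marked) mark-halts
      (layout (λ {y} _ → init y) λ {y} _ → (λ _ → init y) , λ n≤y → contradiction (Fin.toℕ<n y) (ℕ.≤⇒≯ n≤y)))
    λ σ₁ marked →
    seq-halts (weaken (downwards-halts (Pointers ∘ Tallied) tallyUp-halts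
      (layout (idle marked) λ {y} y-root →
        trans (proj₂ (root marked y-root) z≤n) (cong neg (sym (tally-top y)))))
    λ σ₂ tallied →
    seq-halts (weaken (forward-halts
      (layout (idle tallied) λ {y} y-root → trans (root tallied y-root) (cong neg (tally-bottom y))))
    λ σ₃ (at-ℓ₃ , scan) →
    seq-halts (weaken (backward-halts at-ℓ₃ scan) λ σ₄ sums →
    weaken (downwards-halts Claimed claim-halts
      (layout (λ {y} y-idle → (λ _ → idle sums y-idle) , λ n≤y → contradiction (Fin.toℕ<n y) (ℕ.≤⇒≯ n≤y))
        λ y-root → trans (root sums y-root) (cong neg (below-suc-root y-root))))
    λ σ₅ claimed x → final σ₅ claimed x (root? x)))))
    where
    open Corresponding ι using (permutationOf; signed-root; signed-idle)
    final : ∀ σ → Claimed 0 (contents σ) → ∀ x → Dec (Root x) →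
            contents σ x ≡ IdempotentPermutation.signed permutationOf x
    final σ claimed x (yes x-root) = trans (root claimed x-root) (trans
      (cong (λ i → neg (suc i)) (trans (cong (λ i → below (toℕ x) + i) (idleBelow-bottom x)) (ℕ.+-identityʳ _)))
      (sym (signed-root x-root)))
    final σ claimed x (no x-idle) = trans (proj₂ (idle claimed x-idle) z≤n) (sym (signed-idle x-idle))

sum-of-multiples : ∀ n → 37 * n + (47 * n + (53 * n + (62 * n + 69 * n))) ≡ 268 * n
sum-of-multiples n = begin
  37 * n + (47 * n + (53 * n + (62 * n + 69 * n)))
    ≡⟨ cong (λ k → 37 * n + (47 * n + (53 * n + k))) (ℕ.*-distribʳ-+ n 62 69) ⟨
  37 * n + (47 * n + (53 * n + 131 * n))
    ≡⟨ cong (λ k → 37 * n + (47 * n + k)) (ℕ.*-distribʳ-+ n 53 131) ⟨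
  37 * n + (47 * n + 184 * n)
    ≡⟨ cong (λ k → 37 * n + k) (ℕ.*-distribʳ-+ n 47 184) ⟨
  37 * n + 231 * n
    ≡⟨ ℕ.*-distribʳ-+ n 37 231 ⟨
  268 * n ∎
  where open ≡-Reasoning

algorithm : Algorithm
algorithm = record { registers = 1 ; width = width ; program = program }

theorem3p21 : Σ[ alg ∈ Algorithm ] Σ[ C ∈ ℕ ]
    ((n : ℕ) → .{{_ : NonZero n}} →
    (Algorithm.additionalBits alg n ≤ ⌈log₂ n ⌉)
    × ((ι : IdempotentMap n) (r : Registers (Algorithm.width alg n)) →
    Σ[ D ∈ Array n ] Σ[ r′ ∈ Registers (Algorithm.width alg n) ] Σ[ t ∈ ℕ ]
    (Algorithm.Run alg n (store ι , r) t (D , r′)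
    × t ≤ C * n
    × Σ[ k ∈ ℕ ] Σ[ p ∈ IdempotentPermutation n k ]
    (Corresponds p ι
    × (∀ x → value (D x) ≡ IdempotentPermutation.signed p x)))))
theorem3p21 = algorithm , 268 , λ where
  (suc m) → ℕ.≤-reflexive (ℕ.+-identityʳ _) , λ ι r →
    let (D , r′) , t , run , t≤ , final = Correctness.program-halts ι {store ι , r} (λ _ → refl)
        open Corresponding ι
    in D , r′ , t , run , ℕ.≤-trans t≤ (ℕ.≤-reflexive (sum-of-multiples (suc m))) ,
       k , permutationOf , corresponds , final
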